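{- Let $\mathcal{M}_1 = (V, \mathcal{I}_1)$ and $\mathcal{M}_2 = (V, \mathcal{I}_2)$ be two matroids on the same ground set $V$, with ranks $r_1$ and $r_2$ respectively, and let $r$ be the maximum cardinality of a common independent set. For any $\varepsilon > 0$, there is a deterministic semi-streaming algorithm that finds a common independent set $S \in \mathcal{I}_1 \cap \mathcal{I}_2$ with $|S| \geq (2/3 - \varepsilon) r$, using $O(\frac{r_1 + r_2}{\varepsilon})$ memory and $O(\frac{1}{\varepsilon})$ passes.
   Context: A matroid $\mathcal{M} = (V,\mathcal{I})$ is given by a finite ground set $V$ and a nonempty family $\mathcal{I}\subseteq 2^V$ of independent sets satisfying the downward closure and augmentation properties; its rank is the maximum size of an independent set. A common independent set is a set in $\mathcal{I}_1\cap\mathcal{I}_2$. In the (adversarial-order) streaming model, the elements of $V$ arrive one by one in an arbitrary order, and the algorithm may read this stream multiple times (each full read is a pass); it can only store a limited number of elements (memory measured in number of stored elements), and it may test independence in $\mathcal{M}_1$ or $\mathcal{M}_2$ of any set consisting of stored elements and the currently arriving element. A semi-streaming algorithm for matroid intersection uses memory $O((r_1+r_2)\,\mathrm{polylog}(r_1+r_2))$. -}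

module Defs where

open import Data.Nat using (ℕ; zero; suc; _+_; _⊔_; _^_; _≤_; _<_)
open import Data.Bool using (Bool)
open import Data.Fin using (Fin)
open import Data.Fin.Subset using (Subset; ⊥; ⁅_⁆; _∪_; _⊆_; _∈_; _∉_; ∣_∣)
open import Data.List using (List; []; _∷_; length; foldr)
open import Data.Maybe using (Maybe; just; nothing)
open import Data.Product using (Σ; _×_; _,_; ∃-syntax)
open import Data.Sum using (_⊎_; inj₁; inj₂)
open import Data.Integer using (+_)
open import Data.Rational using (ℚ; _/_)
open import Relation.Nullary using (Dec; ¬_)
open import Relation.Nullary.Decidable using (⌊_⌋)

record Matroid (n : ℕ) : Set₁ where
  field
    Indep      : Subset n → Set
    indep?     : (A : Subset n) → Dec (Indep A)
    indep-∅    : Indep ⊥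
    indep-down : ∀ {A B} → A ⊆ B → Indep B → Indep A
    indep-aug  : ∀ {A B} → Indep A → Indep B → ∣ A ∣ < ∣ B ∣ →
                 ∃[ x ] (x ∈ B × x ∉ A × Indep (A ∪ ⁅ x ⁆))
open Matroid public

IsRank : ∀ {n} → Matroid n → ℕ → Set
IsRank M r = (∃[ A ] (Indep M A × ∣ A ∣ ≡' r)) × (∀ A → Indep M A → ∣ A ∣ ≤ r)
  where open import Relation.Binary.PropositionalEquality renaming (_≡_ to _≡'_)

CommonIndep : ∀ {n} → Matroid n → Matroid n → Subset n → Set
CommonIndep M₁ M₂ A = Indep M₁ A × Indep M₂ A

IsMaxCommon : ∀ {n} → Matroid n → Matroid n → ℕ → Set
IsMaxCommon M₁ M₂ r =
  (∃[ A ] (CommonIndep M₁ M₂ A × ∣ A ∣ ≡' r)) × (∀ A → CommonIndep M₁ M₂ A → ∣ A ∣ ≤ r)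
  where open import Relation.Binary.PropositionalEquality renaming (_≡_ to _≡'_)

fromList : ∀ {n} → List (Fin n) → Subset n
fromList = foldr (λ x A → ⁅ x ⁆ ∪ A) ⊥

-- Streaming model.
-- The algorithm is polymorphic in the element type E, so it can only
-- handle elements abstractly: store them, discard them, output stored
-- ones, and query the independence oracles on lists built from stored
-- elements and the currently arriving one.  Besides stored elements it
-- keeps a list of machine words (natural numbers); memory = number of
-- stored elements + number of stored words, and every word must fit in
-- O(log n) bits (checked in the theorem).

Oracle : Set → Set
Oracle E = List E → Bool

record Mem (E : Set) : Set where
  constructor mem
  field
    elems : List E
    words : List ℕ
open Mem public

size : ∀ {E} → Mem E → ℕ
size m = length (elems m) + length (words m)

maxWord : ∀ {E} → Mem E → ℕ
maxWord m = foldr _⊔_ 0 (words m)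

record StreamAlg : Set₁ where
  field
    init    : (n : ℕ) → List ℕ
    step    : {E : Set} → Oracle E → Oracle E → (n pass : ℕ) → Mem E → E → Mem E
    endPass : {E : Set} → Oracle E → Oracle E → (n pass : ℕ) → Mem E → Mem E ⊎ List E
open StreamAlg public

-- statistics of a run: (output , number of passes , peak memory , peak word value)
Result : Set → Set
Result E = List E × ℕ × ℕ × ℕ

module Run (A : StreamAlg) {E : Set} (o₁ o₂ : Oracle E) (n : ℕ) (stream : List E) where

  pass : ℕ → Mem E → List E → Mem E × ℕ × ℕ
  pass i m []       = m , size m , maxWord m
  pass i m (x ∷ xs) with pass i (step A o₁ o₂ n i m x) xs
  ... | m' , s , w = m' , size m ⊔ s , maxWord m ⊔ w

  go : (fuel i : ℕ) → Mem E → Maybe (Result E)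
  go zero    i m = nothing
  go (suc f) i m with pass i m stream
  ... | m' , s , w with endPass A o₁ o₂ n i m'
  ...   | inj₂ out = just (out , suc i , s , w)
  ...   | inj₁ m'' with go f (suc i) m''
  ...     | nothing = nothing
  ...     | just (out , p , s' , w') =
              just (out , p , s ⊔ size m'' ⊔ s' , w ⊔ maxWord m'' ⊔ w')

  Halts : Result E → Set
  Halts res = ∃[ fuel ] (go fuel 0 (mem [] (init A n)) ≡' just res)
    where open import Relation.Binary.PropositionalEquality renaming (_≡_ to _≡'_)

oracle : ∀ {n} → Matroid n → Oracle (Fin n)
oracle M xs = ⌊ indep? M (fromList xs) ⌋

ℕ→ℚ : ℕ → ℚ
ℕ→ℚ k = + k / 1

IsStream : (n : ℕ) → List (Fin n) → Set
IsStream n s = s ↭ Data.List.allFin n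
  where open import Data.List.Relation.Binary.Permutation.Propositional using (_↭_)
        import Data.List

{-# OPTIONS --safe #-}
-- Let S be a maximal common independent set, partitioned into fresh (F), active (A) and
-- dead (R) elements.  Sets B₁, B₂ of the size of A with S + B₁, S − A + B₂ independent in M₁
-- and S + B₂, S − A + B₁ independent in M₂ yield the common independent set S − A + B₁ + B₂,
-- because B₁ lies in the M₂-span of S and B₂ in its M₁-span.  A round first extends B₁
-- greedily, keeping S + B₁ independent in M₁ and R + B₁ in M₂, and activates fresh elements
-- accordingly; then it extends B₂, keeping S + B₂ independent in M₂ and F + B₂ in M₁.  Active
-- elements that B₂ does not replace die.  When the extensions stall, every element is spanned
-- by S + B₁ in M₁ or by R + B₁ in M₂, and also by S + B₂ in M₂ or by F + B₂ in M₁; hence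
-- 2 |O| ≤ 3 (|S| + |B₂|) + #(elements dying in this round) for every common independent O.
-- At most |S| elements die altogether, so in one of K ≥ 1/ε rounds at most ε |S| die, and the
-- rounds after it never lose what has been gained because B₂ only grows.
module Submission where

open import Defs
open import Data.Nat using (ℕ; zero; suc; _+_; _*_; _^_; _⊔_; _≤_; _<_; z≤n; s≤s; _≡ᵇ_)
open import Data.Fin using (Fin; zero; suc)
open import Data.Fin.Subset using (Subset; inside; outside; ⁅_⁆; _∪_; ∣_∣)
open import Data.List using (List; []; _∷_; _++_; [_]; length; foldl; foldr; filter; map; zip; splitAt; allFin)
open import Data.Product using (_×_; _,_; ∃-syntax; proj₁; proj₂)
open import Data.Integer using (+_; -[1+_])
open import Data.Rational using (ℚ; 0ℚ; 1ℚ; _/_; _-_; mkℚ; toℚᵘ; *<*; *≤*)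
  renaming (_*_ to _*ℚ_; _≤_ to _≤ℚ_; _<_ to _<ℚ_)
open import Data.Bool using (Bool; true; false; if_then_else_; _∧_)
open import Data.List.Membership.Propositional using (_∈_)
open import Data.List.Membership.Propositional.Properties using (∈-++⁺ˡ; ∈-++⁺ʳ; ∈-++⁻; ∈-allFin; ∈-filter⁺; ∈-filter⁻)
open import Data.List.Properties using (length-++; length-map; length-tabulate; ++-assoc; ++-identityʳ; map-++; map-∘; map-id)
open import Data.List.Relation.Binary.Permutation.Propositional using (_↭_; ↭-refl; ↭-sym; ↭-trans; prep; ↭⇒↭ₛ)
open import Data.List.Relation.Binary.Permutation.Propositional.Properties
  using (↭-length; ∈-resp-↭; shift; ++-comm; ++⁺ˡ; ++⁺ʳ; ++-commutativeMonoid)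
open import Data.List.Relation.Unary.All as All using (All; []; _∷_)
open import Data.List.Relation.Unary.All.Properties using (all-filter; map⁺; ++⁺; ¬Any⇒All¬; All¬⇒¬Any)
open import Data.List.Relation.Unary.AllPairs using ([]; _∷_)
open import Data.List.Relation.Unary.Any using (here; there)
open import Data.List.Relation.Unary.Unique.DecPropositional using (unique?)
open import Data.List.Relation.Unary.Unique.Propositional using (Unique)
open import Data.Maybe using (just)
open import Data.Nat.Coprimality using (Coprime)
open import Data.Rational.Unnormalised using (mkℚᵘ)
open import Data.Sum using (_⊎_; inj₁; inj₂)
open import Data.Vec using () renaming (_∷_ to _∷ᵥ_; here to hereᵥ; there to thereᵥ)
open import Function using (_∘_; id)
open import Relation.Binary.PropositionalEquality
  using (_≡_; refl; sym; trans; cong; cong₂; subst; subst₂; setoid; module ≡-Reasoning)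
open import Relation.Nullary using (¬_; Dec; yes; no; does; proof; contradiction; ofʸ; ofⁿ)
open import Relation.Nullary.Decidable using (⌊_⌋; map′; ¬?; _×-dec_)
open import Relation.Unary using (Decidable)
import Data.Fin as Fin
import Data.Fin.Subset as Sub
import Data.Fin.Subset.Properties as Subₚ
import Data.Integer as ℤ
import Data.Integer.Properties as ℤₚ
import Data.Integer.Solver
import Data.List.Relation.Unary.Unique.Propositional.Properties as Uniqueₚ
import Data.Nat.DivMod as DivMod
import Data.Nat.Properties as ℕₚ
import Data.Nat.Solver
import Data.Rational as ℚ
import Data.Rational.Properties as ℚₚ
import Data.Rational.Unnormalised as ℚᵘ
import Data.Rational.Unnormalised.Properties as ℚᵘₚ

open Data.Nat.Solver.+-*-Solver using (_:+_; _:*_; _:=_; con) renaming (solve to solveℕ)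
module ℤS = Data.Integer.Solver.+-*-Solver

-- Greedy selection and matroids on lists

accept : {X : Set} → (List X → Bool) → List X → X → List X
accept p acc x = if p (x ∷ acc) then x ∷ acc else acc

grow : {X : Set} → (List X → Bool) → List X → List X → List X
grow p = foldl (accept p)

reject : {X : Set} → (List X → Bool) → List X → List X → List X
reject p acc []       = []
reject p acc (x ∷ xs) = if p (x ∷ acc) then reject p (x ∷ acc) xs else x ∷ reject p acc xs

module _ {X : Set} where
  open import Algebra.Solver.CommutativeMonoid (++-commutativeMonoid {A = X}) public
    using (solve; _⊜_; _⊕_)

  -- What a one-pass greedy selection needs of its test: by `shrink` a candidate refused now is
  -- refused against every longer accumulator, and by `dup` a stored element is never taken twice.
  record Hereditary (P : List X → Set) : Set where
    field
      dec    : Decidable P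
      shrink : ∀ {x y l} → P (x ∷ y ∷ l) → P (x ∷ l)
      dup    : ∀ {x l} → x ∈ l → ¬ P (x ∷ l)

    test : List X → Bool
    test l = does (dec l)

    shrink* : ∀ {x l} zs → P (x ∷ zs ++ l) → P (x ∷ l)
    shrink* []       = id
    shrink* (z ∷ zs) = shrink* zs ∘ shrink

    grow-valid : ∀ acc xs → P acc → P (grow test acc xs)
    grow-valid acc []       h = h
    grow-valid acc (x ∷ xs) h with dec (x ∷ acc)
    ... | yes h′ = grow-valid (x ∷ acc) xs h′
    ... | no _   = grow-valid acc xs h

    grow-extends : ∀ acc xs → ∃[ zs ] grow test acc xs ≡ zs ++ acc
    grow-extends acc []       = [] , refl
    grow-extends acc (x ∷ xs) with dec (x ∷ acc)
    ... | no _   = grow-extends acc xs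
    ... | yes _  with grow-extends (x ∷ acc) xs
    ...   | zs , eq = zs ++ [ x ] , trans eq (sym (++-assoc zs [ x ] acc))

    ∈-grow : ∀ {x} acc xs → x ∈ acc → x ∈ grow test acc xs
    ∈-grow acc xs x∈ with zs , eq ← grow-extends acc xs =
      subst (_ ∈_) (sym eq) (∈-++⁺ʳ zs x∈)

    -- An accepted element lies in the final accumulator, where `dup` excludes it; a refused one
    -- stays refused, since `shrink*` strips off the later additions `zs`.
    grow-maximal : ∀ acc xs → All (λ x → ¬ P (x ∷ grow test acc xs)) xs
    grow-maximal acc []       = []
    grow-maximal acc (x ∷ xs) with dec (x ∷ acc)
    ... | yes _ = dup (∈-grow (x ∷ acc) xs (here refl)) ∷ grow-maximal (x ∷ acc) xs
    ... | no ¬h with zs , eq ← grow-extends acc xs =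
      ¬h ∘ shrink* zs ∘ subst (λ l → P (x ∷ l)) eq ∷ grow-maximal acc xs

    grow-reject : ∀ acc xs → acc ++ xs ↭ grow test acc xs ++ reject test acc xs
    grow-reject acc []       = ↭-refl
    grow-reject acc (x ∷ xs) with dec (x ∷ acc)
    ... | yes _ = ↭-trans (shift x acc xs) (grow-reject (x ∷ acc) xs)
    ... | no _  = ↭-trans (shift x acc xs)
                    (↭-trans (prep x (grow-reject acc xs)) (↭-sym (shift x _ _)))

    -- By `shrink` every acceptance, however late, is also an acceptance against the initial `acc`.
    grow-origin : ∀ {Q : X → Set} acc xs → (∀ {x} → x ∈ xs → P (x ∷ acc) → Q x) →
                  All Q acc → All Q (grow test acc xs)
    grow-origin acc []       h qs = qs
    grow-origin acc (x ∷ xs) h qs with dec (x ∷ acc)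
    ... | yes p = grow-origin (x ∷ acc) xs (λ x∈ → h (there x∈) ∘ shrink) (h (here refl) p ∷ qs)
    ... | no _  = grow-origin acc xs (h ∘ there) qs

  open Hereditary public

  infixr 2 _∩ʰ_
  _∩ʰ_ : ∀ {P Q} → Hereditary P → Hereditary Q → Hereditary (λ l → P l × Q l)
  hP ∩ʰ hQ = record
    { dec    = λ l → dec hP l ×-dec dec hQ l
    ; shrink = λ (p , q) → shrink hP p , shrink hQ q
    ; dup    = λ x∈ (p , _) → dup hP x∈ p
    }

  filter-split : {Q : X → Set} (Q? : Decidable Q) (xs : List X) →
                 filter Q? xs ++ filter (¬? ∘ Q?) xs ↭ xs
  filter-split Q? []       = ↭-refl
  filter-split Q? (x ∷ xs) with Q? x
  ... | yes _ = prep x (filter-split Q? xs)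
  ... | no _  = ↭-trans (shift x (filter Q? xs) _) (prep x (filter-split Q? xs))

-- By `ind-dup` independent lists are free of repetitions, so `length` is cardinality and exchange
-- arguments become equations between lengths.
record ListMatroid (X : Set) : Set₁ where
  field
    Ind      : List X → Set
    ind?     : Decidable Ind
    ind-[]   : Ind []
    ind-↭    : ∀ {xs ys} → xs ↭ ys → Ind xs → Ind ys
    ind-++ʳ  : ∀ xs {ys} → Ind (xs ++ ys) → Ind ys
    ind-dup  : ∀ {x xs} → x ∈ xs → ¬ Ind (x ∷ xs)
    ind-aug  : ∀ {xs ys} → Ind xs → Ind ys → length xs < length ys →
               ∃[ x ] (x ∈ ys × Ind (x ∷ xs))

  sub : ∀ zs {xs ys} → ys ↭ zs ++ xs → Ind ys → Ind xs
  sub zs eq = ind-++ʳ zs ∘ ind-↭ eq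

  -- The context stands on both sides so that this predicate is literally what a test of the
  -- algorithm evaluates, with no permutation in between.
  between : ∀ us vs → Hereditary (λ zs → Ind (us ++ zs ++ vs))
  between us vs = record
    { dec    = λ zs → ind? (us ++ zs ++ vs)
    ; shrink = λ {x} {y} {l} → sub [ y ]
        (solve 5 (λ u x y l v → u ⊕ ((x ⊕ (y ⊕ l)) ⊕ v) ⊜ y ⊕ (u ⊕ ((x ⊕ l) ⊕ v))) ↭-refl us [ x ] [ y ] l vs)
    ; dup    = λ {x} {l} x∈ → ind-dup (∈-++⁺ʳ us (∈-++⁺ˡ x∈)) ∘ ind-↭ (shift x us (l ++ vs))
    }

  infix 4 _spans_
  -- For independent `T` this is containment in the closure of `T`; members of `T` are covered by
  -- `ind-dup`.
  _spans_ : List X → List X → Set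
  T spans Q = All (λ q → ¬ Ind (q ∷ T)) Q

  spans-⊆ : ∀ {T Q} → (∀ {x} → x ∈ Q → x ∈ T) → T spans Q
  spans-⊆ Q⊆T = All.tabulate (ind-dup ∘ Q⊆T)

  spans-length : ∀ {T Q} → Ind T → Ind Q → T spans Q → length Q ≤ length T
  spans-length {T} {Q} hT hQ sp with length Q ℕₚ.≤? length T
  ... | yes le = le
  ... | no ¬le with q , q∈ , h ← ind-aug hT hQ (ℕₚ.≰⇒> ¬le) = contradiction h (All.lookup sp q∈)

  each : ∀ xs {ys} → Ind (xs ++ ys) → All (λ x → Ind (x ∷ ys)) xs
  each []       h = []
  each (x ∷ xs) {ys} h =
    sub xs (↭-sym (shift x xs ys)) h ∷ each xs (sub [ x ] ↭-refl h)

  -- Q is first completed greedily inside P to Q′ of size at most |P|; augmenting Q′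
  -- from P ++ Y can then only bring in elements of Y.
  exchange : ∀ Y {P Q} → Ind (Y ++ P) → Ind Q → P spans Q → Ind (Y ++ Q)
  exchange Y {P} {Q} hYP hQ sp = sub zs (solve 3 (λ y z q → y ⊕ (z ⊕ q) ⊜ z ⊕ (y ⊕ q)) ↭-refl Y zs Q) (extend Y hYP)
    where
    H : Hereditary (λ l → Ind (l ++ Q))
    H = between [] Q
    zs Q′ : List X
    zs = grow (test H) [] P
    Q′ = zs ++ Q
    hQ′ : Ind Q′
    hQ′ = grow-valid H [] P hQ
    P-spans : P spans Q′
    P-spans = ++⁺ (grow-origin H [] P (λ p∈ _ → ind-dup p∈) []) sp
    extend : ∀ Y → Ind (Y ++ P) → Ind (Y ++ Q′)
    extend []      _ = hQ′
    extend (y ∷ Y) h = case (ind-aug hY h (s≤s shorter))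
      where
      hY : Ind (Y ++ Q′)
      hY = extend Y (sub [ y ] ↭-refl h)
      shorter : length (Y ++ Q′) ≤ length (Y ++ P)
      shorter rewrite length-++ Y {Q′} | length-++ Y {P} =
        ℕₚ.+-monoʳ-≤ (length Y) (spans-length (sub Y ↭-refl (sub [ y ] ↭-refl h)) hQ′ P-spans)
      case : ∃[ x ] (x ∈ y ∷ Y ++ P × Ind (x ∷ Y ++ Q′)) → Ind (y ∷ Y ++ Q′)
      case (_ , here refl , hx) = hx
      case (x , there x∈ , hx) with ∈-++⁻ Y x∈
      ... | inj₁ x∈Y = contradiction hx (ind-dup (∈-++⁺ˡ x∈Y))
      ... | inj₂ x∈P = contradiction
        (sub Y (solve 3 (λ x y q → x ⊕ (y ⊕ q) ⊜ y ⊕ (x ⊕ q)) ↭-refl [ x ] Y Q′) hx)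
        (All.lookup (grow-maximal H [] P) x∈P)

open ListMatroid

-- The easy half of the matroid intersection min-max theorem: the elements of `O` that `P` does not
-- span in `M` are spanned by `Q` in `N`, and neither portion of `O` can be longer than the set
-- spanning it.
weak-duality : ∀ {X} (M N : ListMatroid X) {O P Q} →
  Ind M O → Ind N O → Ind M P → Ind N Q →
  (∀ v → Ind M (v ∷ P) → ¬ Ind N (v ∷ Q)) → length O ≤ length P + length Q
weak-duality M N {O} {P} {Q} oM oN pM qN sp = begin
  length O                     ≡⟨ ↭-length (filter-split free? O) ⟨
  length (free ++ rest)        ≡⟨ length-++ free ⟩
  length free + length rest    ≡⟨ ℕₚ.+-comm (length free) _ ⟩
  length rest + length free    ≤⟨ ℕₚ.+-mono-≤ (spans-length M pM restM (all-filter (¬? ∘ free?) O))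
                                   (spans-length N qN freeN (All.map (sp _) (all-filter free? O))) ⟩
  length P + length Q          ∎
  where
  open ℕₚ.≤-Reasoning
  free? : Decidable (λ v → Ind M (v ∷ P))
  free? v = ind? M (v ∷ P)
  free rest : List _
  free = filter free? O
  rest = filter (¬? ∘ free?) O
  restM : Ind M rest
  restM = sub M free (↭-sym (filter-split free? O)) oM
  freeN : Ind N free
  freeN = sub N rest (↭-trans (↭-sym (filter-split free? O)) (++-comm free rest)) oN

-- The rounds

-- basis, left and right are S, B₁ and B₂.
record State (X : Set) : Set where
  constructor state
  field
    fresh active dead left right : List X

  basis : List X
  basis = fresh ++ active ++ dead

open State

module Algorithm {X : Set} (t₁ t₂ : List X → Bool) where

  -- Seeding starts from the empty state, where `seedTest` amounts to common independence. Its
  -- contexts `left s` and `right s` make acceptance preserve `Small` in every state.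
  seedTest leftTest rightTest : State X → List X → Bool
  seedTest  s l = t₁ (left s ++ l ++ active s ++ dead s) ∧ t₂ (right s ++ l ++ active s ++ dead s)
  leftTest  s l = t₁ (l ++ basis s) ∧ t₂ (l ++ dead s)
  rightTest s l = t₂ (l ++ basis s) ∧ t₁ (l ++ fresh s)

  -- Settling restores lists of the size of the basis. A fresh element is activated if the enlarged
  -- `left` makes it redundant in the second matroid; an active one dies if `right` fails to make it
  -- redundant in the first; `keepTest` then trims `left` to the number of survivors.
  freshTest activeTest keepTest : State X → List X → Bool
  dead⁺ : State X → List X
  freshTest  s l = t₂ (l ++ left s ++ dead s)
  activeTest s l = t₁ (l ++ right s ++ fresh s ++ dead s)
  dead⁺      s   = grow (activeTest s) [] (active s) ++ dead s
  keepTest   s l = t₂ (l ++ fresh s ++ dead⁺ s)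

  settleLeft : State X → State X
  settleLeft s = record s
    { fresh  = grow (freshTest s) [] (fresh s)
    ; active = reject (freshTest s) [] (fresh s) ++ active s
    }

  settleRight : State X → State X
  settleRight s = record s
    { active = reject (activeTest s) [] (active s)
    ; dead   = dead⁺ s
    ; left   = grow (keepTest s) [] (left s)
    }

-- Invariants of the exchange sets and analysis of one round

module Analysis {X : Set} (M₁ M₂ : ListMatroid X) where
  open ListMatroid M₁ using () renaming (Ind to Ind₁; ind? to ind₁?; _spans_ to _spans₁_; sub to sub₁)
  open ListMatroid M₂ using () renaming (Ind to Ind₂; ind? to ind₂?; _spans_ to _spans₂_; sub to sub₂)
  open Algorithm (does ∘ ind₁?) (does ∘ ind₂?) public

  spans-antisym : ∀ (M : ListMatroid X) {T Q} → Ind M T → Ind M Q → _spans_ M T Q → _spans_ M Q T →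
                  length T ≡ length Q
  spans-antisym M hT hQ T⊒Q Q⊒T = ℕₚ.≤-antisym (spans-length M hQ hT Q⊒T) (spans-length M hT hQ T⊒Q)

  length-++₃ : ∀ (xs ys zs : List X) → length (xs ++ ys ++ zs) ≡ length xs + (length ys + length zs)
  length-++₃ xs ys zs = trans (length-++ xs) (cong (_+_ (length xs)) (length-++ ys))

  -- `blocked` records that the previous search for `right` stalled. Whatever becomes admissible
  -- once `fresh` shrinks is still spanned by the old `right s ++ fresh s`, which keeps the enlarged
  -- `right` independent together with the dead elements.
  record Invariant (s : State X) : Set where
    field
      maximal : ∀ v → Ind₁ (v ∷ basis s) → ¬ Ind₂ (v ∷ basis s)
      left₁   : Ind₁ (left s ++ basis s)
      left₂   : Ind₂ (left s ++ fresh s ++ dead s)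
      right₁  : Ind₁ (right s ++ fresh s ++ dead s)
      right₂  : Ind₂ (right s ++ basis s)
      ∣left∣  : length (left s) ≡ length (active s)
      ∣right∣ : length (right s) ≡ length (active s)
      blocked : ∀ v → Ind₂ (v ∷ right s ++ basis s) → ¬ Ind₁ (v ∷ right s ++ fresh s)

    basis₁ : Ind₁ (basis s)
    basis₁ = sub₁ (left s) ↭-refl left₁
    basis₂ : Ind₂ (basis s)
    basis₂ = sub₂ (right s) ↭-refl right₂

    fresh⊆ : ∀ {x} → x ∈ fresh s → x ∈ basis s
    fresh⊆ = ∈-++⁺ˡ
    dead⊆ : ∀ {x} → x ∈ dead s → x ∈ basis s
    dead⊆ = ∈-++⁺ʳ (fresh s) ∘ ∈-++⁺ʳ (active s)

    -- An element of `left s` extends the basis in `M₁`, so by maximality it cannot extend it in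
    -- `M₂`.
    spans-left : basis s spans₂ left s
    spans-left = All.map (maximal _) (each M₁ (left s) left₁)
    spans-right : basis s spans₁ right s
    spans-right = All.map (λ h₂ h₁ → maximal _ h₁ h₂) (each M₂ (right s) right₂)

    -- `left s` is independent over the basis, hence by `exchange` over any independent list that
    -- the basis spans in `M₁`.
    augmented₁ : Ind₁ (left s ++ right s ++ fresh s ++ dead s)
    augmented₁ = exchange M₁ (left s) left₁ right₁
      (++⁺ spans-right (++⁺ (spans-⊆ M₁ fresh⊆) (spans-⊆ M₁ dead⊆)))

    augmented₂ : Ind₂ (left s ++ right s ++ fresh s ++ dead s)
    augmented₂ = ind-↭ M₂
      (solve 4 (λ l r f d → r ⊕ (l ⊕ (f ⊕ d)) ⊜ l ⊕ (r ⊕ (f ⊕ d))) ↭-refl (left s) (right s) (fresh s) (dead s))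
      (exchange M₂ (right s) right₂ left₂ (++⁺ spans-left (++⁺ (spans-⊆ M₂ fresh⊆) (spans-⊆ M₂ dead⊆))))

    ∣augmented∣ : length (left s ++ right s ++ fresh s ++ dead s) ≡ length (right s) + length (basis s)
    ∣augmented∣ = trans (length-++₃ (left s) (right s) _)
      (trans (cong₂ (λ l k → l + (length (right s) + k)) ∣left∣ (length-++ (fresh s)))
        (trans (solveℕ 4 (λ a b f d → a :+ (b :+ (f :+ d)) := b :+ (f :+ (a :+ d))) refl
                 (length (active s)) (length (right s)) (length (fresh s)) (length (dead s)))
          (cong (_+_ (length (right s))) (sym (length-++₃ (fresh s) (active s) (dead s))))))

  module Round {V : List X} (complete : ∀ v → v ∈ V) {s : State X} (inv : Invariant s) where
    open Invariant inv
    open State s renaming (fresh to F; active to A; dead to R; left to B₁; right to B₂; basis to S)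

    leftH : Hereditary _
    leftH = between M₁ [] S ∩ʰ between M₂ [] R

    s₁ s₂ s₃ s₄ : State X
    s₁ = record s { left = grow (leftTest s) B₁ V }
    s₂ = settleLeft s₁
    s₃ = record s₂ { right = grow (rightTest s₂) B₂ V }
    s₄ = settleRight s₃

    L : List X
    L = left s₁

    L-valid : Ind₁ (L ++ S) × Ind₂ (L ++ R)
    L-valid = grow-valid leftH B₁ V
      (left₁ , sub₂ F (solve 3 (λ b f r → b ⊕ (f ⊕ r) ⊜ f ⊕ (b ⊕ r)) ↭-refl B₁ F R) left₂)

    L-maximal : ∀ v → Ind₁ (v ∷ L ++ S) → ¬ Ind₂ (v ∷ L ++ R)
    L-maximal v h₁ h₂ = All.lookup (grow-maximal leftH B₁ V) (complete v) (h₁ , h₂)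

    S-spans-L : S spans₂ L
    S-spans-L = All.map (maximal _) (each M₁ L (proj₁ L-valid))

    freshH : Hereditary _
    freshH = between M₂ [] (L ++ R)

    F′ D A′ : List X
    F′ = fresh s₂
    D  = reject (test freshH) [] F
    A′ = active s₂

    F-split : F ↭ F′ ++ D
    F-split = grow-reject freshH [] F

    F′⊆F : ∀ {x} → x ∈ F′ → x ∈ F
    F′⊆F = ∈-resp-↭ (↭-sym F-split) ∘ ∈-++⁺ˡ

    F′-valid : Ind₂ (F′ ++ L ++ R)
    F′-valid = grow-valid freshH [] F (proj₂ L-valid)

    S-perm : S ↭ basis s₂
    S-perm = ↭-trans (++⁺ʳ (A ++ R) F-split)
      (solve 4 (λ f d a r → (f ⊕ d) ⊕ (a ⊕ r) ⊜ f ⊕ ((d ⊕ a) ⊕ r)) ↭-refl F′ D A R)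

    -- The basis spans `F′ ++ L ++ R` in `M₂`. Conversely this list spans `B₁ ++ F ++ R`, since `L`
    -- extends `B₁` and `F′` is greedily maximal in `F`; and `B₁ ++ F ++ R` is already as long as
    -- the basis.
    F′-size : length (F′ ++ L ++ R) ≡ length S
    F′-size = ℕₚ.≤-antisym
      (spans-length M₂ basis₂ F′-valid
        (++⁺ {xs = F′} (spans-⊆ M₂ (fresh⊆ ∘ F′⊆F)) (++⁺ S-spans-L (spans-⊆ M₂ dead⊆))))
      (subst (_≤ length (F′ ++ L ++ R)) old-size (spans-length M₂ F′-valid left₂
        (++⁺ (spans-⊆ M₂ (∈-++⁺ʳ F′ ∘ ∈-++⁺ˡ ∘ ∈-grow leftH B₁ V))
          (++⁺ (grow-maximal freshH [] F) (spans-⊆ M₂ (∈-++⁺ʳ F′ ∘ ∈-++⁺ʳ L))))))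
      where
      old-size : length (B₁ ++ F ++ R) ≡ length S
      old-size = trans (length-++₃ B₁ F R) (trans (cong (_+ (length F + length R)) ∣left∣)
        (trans (solveℕ 3 (λ a f r → a :+ (f :+ r) := f :+ (a :+ r)) refl (length A) (length F) (length R))
          (sym (length-++₃ F A R))))

    -- Activation keeps pace with the growth of `left`: `L` and `A′` complete the same `F′` and `R`
    -- to lists of equal length.
    A′-size : length L ≡ length A′
    A′-size = ℕₚ.+-cancelʳ-≡ (length R) _ _ (ℕₚ.+-cancelˡ-≡ (length F′) _ _
      (trans (sym (length-++₃ F′ L R)) (trans F′-size (trans (↭-length S-perm) (length-++₃ F′ A′ R)))))

    rightH : Hereditary _
    rightH = between M₂ [] (basis s₂) ∩ʰ between M₁ [] F′

    B : List X
    B = right s₃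

    B-valid : Ind₂ (B ++ basis s₂) × Ind₁ (B ++ F′)
    B-valid = grow-valid rightH B₂ V
      ( ind-↭ M₂ (++⁺ˡ B₂ S-perm) right₂
      , sub₁ (D ++ R) (↭-trans (++⁺ˡ B₂ (++⁺ʳ R F-split))
          (solve 4 (λ b f d r → b ⊕ ((f ⊕ d) ⊕ r) ⊜ (d ⊕ r) ⊕ (b ⊕ f)) ↭-refl B₂ F′ D R)) right₁ )

    B-maximal : ∀ v → Ind₂ (v ∷ B ++ basis s₂) → ¬ Ind₁ (v ∷ B ++ F′)
    B-maximal v h₂ h₁ = All.lookup (grow-maximal rightH B₂ V) (complete v) (h₂ , h₁)

    -- Everything that ever enters B is blocked by B₂ ++ F, over which R is independent.
    B-dead : Ind₁ (B ++ F′ ++ R)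
    B-dead = ind-↭ M₁ (solve 3 (λ b f r → r ⊕ (b ⊕ f) ⊜ b ⊕ (f ⊕ r)) ↭-refl B F′ R)
      (exchange M₁ R (ind-↭ M₁ (solve 3 (λ b f r → b ⊕ (f ⊕ r) ⊜ r ⊕ (b ⊕ f)) ↭-refl B₂ F R) right₁)
        (proj₂ B-valid)
        (++⁺ (grow-origin rightH B₂ V
               (λ _ (h₂ , _) → blocked _ (ind-↭ M₂ (prep _ (++⁺ˡ B₂ (↭-sym S-perm))) h₂))
               (spans-⊆ M₁ ∈-++⁺ˡ))
             (spans-⊆ M₁ (∈-++⁺ʳ B₂ ∘ F′⊆F))))

    S₂-spans-B : basis s₂ spans₁ B
    S₂-spans-B = All.map (λ h₂ h₁ → maximal _ (ind-↭ M₁ (prep _ (↭-sym S-perm)) h₁)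
                                             (ind-↭ M₂ (prep _ (↭-sym S-perm)) h₂))
                   (each M₂ B (proj₁ B-valid))

    deadH : Hereditary _
    deadH = between M₁ [] (B ++ F′ ++ R)

    T A″ R′ : List X
    T  = grow (test deadH) [] A′
    A″ = active s₄
    R′ = dead s₄

    A′-split : A′ ↭ T ++ A″
    A′-split = grow-reject deadH [] A′

    T⊆A′ : ∀ {x} → x ∈ T → x ∈ A′
    T⊆A′ = ∈-resp-↭ (↭-sym A′-split) ∘ ∈-++⁺ˡ

    S₂-perm : basis s₂ ↭ basis s₄
    S₂-perm = ↭-trans (++⁺ˡ F′ (++⁺ʳ R A′-split))
      (solve 4 (λ f t a r → f ⊕ ((t ⊕ a) ⊕ r) ⊜ f ⊕ (a ⊕ (t ⊕ r))) ↭-refl F′ T A″ R)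

    S₄-perm : S ↭ basis s₄
    S₄-perm = ↭-trans S-perm S₂-perm

    F′⊆S₂ : ∀ {x} → x ∈ F′ → x ∈ basis s₂
    F′⊆S₂ = ∈-++⁺ˡ
    A′⊆S₂ : ∀ {x} → x ∈ A′ → x ∈ basis s₂
    A′⊆S₂ = ∈-++⁺ʳ F′ ∘ ∈-++⁺ˡ
    R⊆S₂ : ∀ {x} → x ∈ R → x ∈ basis s₂
    R⊆S₂ = ∈-++⁺ʳ F′ ∘ ∈-++⁺ʳ A′

    T-valid : Ind₁ (T ++ B ++ F′ ++ R)
    T-valid = grow-valid deadH [] A′ B-dead

    S₂₁ : Ind₁ (basis s₂)
    S₂₁ = ind-↭ M₁ S-perm basis₁
    S₂₂ : Ind₂ (basis s₂)
    S₂₂ = ind-↭ M₂ S-perm basis₂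

    -- The two lists span each other in `M₁`: greedy maximality of `T` covers the active elements,
    -- maximality of the basis covers `B`.
    T-size : length (T ++ B ++ F′ ++ R) ≡ length (basis s₂)
    T-size = spans-antisym M₁ T-valid S₂₁
      (++⁺ {xs = F′} (spans-⊆ M₁ (∈-++⁺ʳ T ∘ ∈-++⁺ʳ B ∘ ∈-++⁺ˡ))
        (++⁺ (grow-maximal deadH [] A′) (spans-⊆ M₁ (∈-++⁺ʳ T ∘ ∈-++⁺ʳ B ∘ ∈-++⁺ʳ F′))))
      (++⁺ {xs = T} (spans-⊆ M₁ (A′⊆S₂ ∘ T⊆A′)) (++⁺ S₂-spans-B (++⁺ {xs = F′} (spans-⊆ M₁ F′⊆S₂) (spans-⊆ M₁ R⊆S₂))))

    A″-size : length B ≡ length A″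
    A″-size = ℕₚ.+-cancelˡ-≡ (length T + (length F′ + length R)) _ _ eq
      where
      open ≡-Reasoning
      t b f r a : ℕ
      t = length T
      b = length B
      f = length F′
      r = length R
      a = length A″
      eq : t + (f + r) + b ≡ t + (f + r) + a
      eq = begin
        t + (f + r) + b               ≡⟨ solveℕ 4 (λ t b f r → t :+ (f :+ r) :+ b := t :+ (b :+ (f :+ r))) refl t b f r ⟩
        t + (b + (f + r))             ≡⟨ cong (λ k → t + (b + k)) (length-++ F′) ⟨
        t + (b + length (F′ ++ R))    ≡⟨ length-++₃ T B (F′ ++ R) ⟨
        length (T ++ B ++ F′ ++ R)    ≡⟨ T-size ⟩
        length (basis s₂)             ≡⟨ ↭-length S₂-perm ⟩
        length (F′ ++ A″ ++ T ++ R)   ≡⟨ length-++₃ F′ A″ (T ++ R) ⟩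
        f + (a + length (T ++ R))     ≡⟨ cong (λ k → f + (a + k)) (length-++ T) ⟩
        f + (a + (t + r))             ≡⟨ solveℕ 4 (λ t a f r → f :+ (a :+ (t :+ r)) := t :+ (f :+ r) :+ a) refl t a f r ⟩
        t + (f + r) + a               ∎

    keepH : Hereditary _
    keepH = between M₂ [] (F′ ++ R′)

    B′ : List X
    B′ = left s₄

    L-split : L ↭ B′ ++ reject (test keepH) [] L
    L-split = grow-reject keepH [] L

    B′-valid : Ind₂ (B′ ++ F′ ++ R′)
    B′-valid = grow-valid keepH [] L
      (sub₂ A″ (↭-trans S₂-perm (solve 3 (λ f a r → f ⊕ (a ⊕ r) ⊜ a ⊕ (f ⊕ r)) ↭-refl F′ A″ R′)) S₂₂)

    S₄-spans-L : basis s₄ spans₂ L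
    S₄-spans-L = All.map (λ ¬h → ¬h ∘ ind-↭ M₂ (prep _ (↭-sym S₄-perm))) S-spans-L

    -- One inequality holds because the basis spans `L` in `M₂`. For the other, `B′ ++ F′ ++ R′`
    -- spans `F′ ++ L ++ R`, which has the length of the basis by `F′-size`: the trimmed part of `L`
    -- is redundant, and `R` is part of `R′`.
    B′-size : length B′ ≡ length A″
    B′-size = ℕₚ.+-cancelʳ-≡ (length F′ + length R′) _ _ (begin
      length B′ + (length F′ + length R′)   ≡⟨ length-++₃ B′ F′ R′ ⟨
      length (B′ ++ F′ ++ R′)               ≡⟨ size-eq ⟩
      length (basis s₄)                     ≡⟨ length-++₃ F′ A″ R′ ⟩
      length F′ + (length A″ + length R′)   ≡⟨ solveℕ 3 (λ f a r → f :+ (a :+ r) := a :+ (f :+ r)) refl (length F′) (length A″) (length R′) ⟩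
      length A″ + (length F′ + length R′)   ∎)
      where
      open ≡-Reasoning
      size-eq : length (B′ ++ F′ ++ R′) ≡ length (basis s₄)
      size-eq = ℕₚ.≤-antisym
        (spans-length M₂ (ind-↭ M₂ S₂-perm S₂₂) B′-valid
          (++⁺ {xs = B′} (All.tabulate λ b∈ → All.lookup S₄-spans-L (∈-resp-↭ (↭-sym L-split) (∈-++⁺ˡ b∈)))
            (++⁺ {xs = F′} (spans-⊆ M₂ ∈-++⁺ˡ) (spans-⊆ M₂ (∈-++⁺ʳ F′ ∘ ∈-++⁺ʳ A″)))))
        (subst (_≤ length (B′ ++ F′ ++ R′)) (trans F′-size (↭-length S₄-perm))
          (spans-length M₂ B′-valid F′-valid
            (++⁺ {xs = F′} (spans-⊆ M₂ (∈-++⁺ʳ B′ ∘ ∈-++⁺ˡ))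
              (++⁺ (grow-maximal keepH [] L) (spans-⊆ M₂ (∈-++⁺ʳ B′ ∘ ∈-++⁺ʳ F′ ∘ ∈-++⁺ʳ T))))))

    invariant : Invariant s₄
    invariant = record
      { maximal = λ v h₁ h₂ → maximal v (ind-↭ M₁ (prep v (↭-sym S₄-perm)) h₁) (ind-↭ M₂ (prep v (↭-sym S₄-perm)) h₂)
      ; left₁   = sub₁ (reject (test keepH) [] L)
          (↭-trans (++⁺ˡ L S₄-perm) (↭-trans (++⁺ʳ (basis s₄) L-split)
            (solve 3 (λ b d s → (b ⊕ d) ⊕ s ⊜ d ⊕ (b ⊕ s)) ↭-refl B′ (reject (test keepH) [] L) (basis s₄))))
          (proj₁ L-valid)
      ; left₂   = B′-valid
      ; right₁  = ind-↭ M₁ (solve 4 (λ t b f r → t ⊕ (b ⊕ (f ⊕ r)) ⊜ b ⊕ (f ⊕ (t ⊕ r))) ↭-refl T B F′ R) T-valid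
      ; right₂  = ind-↭ M₂ (++⁺ˡ B S₂-perm) (proj₁ B-valid)
      ; ∣left∣  = B′-size
      ; ∣right∣ = A″-size
      -- `settleRight` leaves `fresh` alone, so the search stalled in this round serves the next
      -- one.
      ; blocked = λ v h₂ → B-maximal v (ind-↭ M₂ (prep v (++⁺ˡ B (↭-sym S₂-perm))) h₂)
      }

    right-grows : length B₂ ≤ length (right s₄)
    right-grows with zs , eq ← grow-extends rightH B₂ V =
      subst (length B₂ ≤_) (trans (sym (length-++ zs)) (cong length (sym eq))) (ℕₚ.m≤n+m _ _)

    dead-grows : length (dead s₄) ≡ length T + length R
    dead-grows = length-++ T

    -- The two dual solutions come from the stalled searches; their values add up to
    -- 3 |S| + |L| + 2 |B|, and |L| exceeds |B| by the number |T| of newly dead elements.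
    bound : ∀ {O} → Ind₁ O → Ind₂ O → 2 * length O ≤ 3 * (length B + length (basis s₄)) + length T
    bound {O} o₁ o₂ = begin
      o + (o + 0)                                              ≡⟨ cong (_+_ o) (ℕₚ.+-identityʳ o) ⟩
      o + o                                                    ≤⟨ ℕₚ.+-mono-≤ (weak-duality M₁ M₂ o₁ o₂ (proj₁ L-valid) (proj₂ L-valid) L-maximal)
                                                                   (weak-duality M₂ M₁ o₂ o₁ (proj₁ B-valid) (proj₂ B-valid) B-maximal) ⟩
      length (L ++ S) + length (L ++ R) + (length (B ++ basis s₂) + length (B ++ F′))
        ≡⟨ cong₂ _+_ (cong₂ _+_ (trans (length-++ L) (cong (_+_ (length L)) (↭-length S₄-perm))) (length-++ L))
                     (cong₂ _+_ (trans (length-++ B) (cong (_+_ b) (↭-length S₂-perm))) (length-++ B)) ⟩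
      length L + k + (length L + r) + (b + k + (b + f))
        ≡⟨ cong (λ l → l + k + (l + r) + (b + k + (b + f))) L-size ⟩
      t + b + k + (t + b + r) + (b + k + (b + f))
        ≡⟨ cong (λ k → t + b + k + (t + b + r) + (b + k + (b + f))) k-size ⟩
      t + b + k′ + (t + b + r) + (b + k′ + (b + f))
        ≡⟨ solveℕ 4 (λ t b f r → t :+ b :+ (f :+ (b :+ (t :+ r))) :+ (t :+ b :+ r) :+ (b :+ (f :+ (b :+ (t :+ r))) :+ (b :+ f))
             := con 3 :* (b :+ (f :+ (b :+ (t :+ r)))) :+ t) refl t b f r ⟩
      3 * (b + k′) + t
        ≡⟨ cong (λ k → 3 * (b + k) + t) k-size ⟨
      3 * (b + k) + t ∎
      where
      open ℕₚ.≤-Reasoning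
      o t b f r k k′ : ℕ
      o = length O
      t = length T
      b = length B
      f = length F′
      r = length R
      k = length (basis s₄)
      k′ = f + (b + (t + r))
      L-size : length L ≡ t + b
      L-size = trans A′-size (trans (↭-length A′-split) (trans (length-++ T) (cong (_+_ t) (sym A″-size))))
      k-size : k ≡ k′
      k-size = trans (length-++₃ F′ A″ R′) (cong₂ (λ x y → f + (x + y)) (sym A″-size) (length-++ T))

-- The streaming algorithm

data Phase : Set where
  seeding growingLeft growingRight : Phase

module Streaming {X : Set} (t₁ t₂ : List X → Bool) where
  open Algorithm t₁ t₂ public

  add : Phase → State X → X → State X
  add seeding      s x = record s { fresh = accept (seedTest s) (fresh s) x }
  add growingLeft  s x = record s { left  = accept (leftTest s) (left s) x }
  add growingRight s x = record s { right = accept (rightTest s) (right s) x }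

  settle : Phase → State X → State X
  settle seeding      s = s
  settle growingLeft  s = settleLeft s
  settle growingRight s = settleRight s

augmented : {X : Set} → State X → List X
augmented s = left s ++ right s ++ fresh s ++ dead s

mapState : {X Y : Set} → (X → Y) → State X → State Y
mapState f s = state (map f (fresh s)) (map f (active s)) (map f (dead s)) (map f (left s)) (map f (right s))

-- The algorithm runs on stored items, its analysis on the elements of the ground set.
module Naturality {X Y : Set} (f : X → Y) (t₁ t₂ : List Y → Bool) where
  module N = Streaming t₁ t₂
  module M = Streaming (t₁ ∘ map f) (t₂ ∘ map f)

  module _ (p : List Y → Bool) {q : List X → Bool} (p≗q : ∀ l → p (map f l) ≡ q l) where

    accept-map : ∀ acc x → accept p (map f acc) (f x) ≡ map f (accept q acc x)
    accept-map acc x with p (f x ∷ map f acc) | p≗q (x ∷ acc)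
    ... | true  | eq rewrite sym eq = refl
    ... | false | eq rewrite sym eq = refl

    grow-map : ∀ acc xs → grow p (map f acc) (map f xs) ≡ map f (grow q acc xs)
    grow-map acc []       = refl
    grow-map acc (x ∷ xs) rewrite accept-map acc x = grow-map (accept q acc x) xs

    reject-map : ∀ acc xs → reject p (map f acc) (map f xs) ≡ map f (reject q acc xs)
    reject-map acc []       = refl
    reject-map acc (x ∷ xs) with p (f x ∷ map f acc) | p≗q (x ∷ acc)
    ... | true  | eq rewrite sym eq = reject-map (x ∷ acc) xs
    ... | false | eq rewrite sym eq = cong (f x ∷_) (reject-map acc xs)

  map-++₃ : ∀ (xs ys zs : List X) → map f xs ++ map f ys ++ map f zs ≡ map f (xs ++ ys ++ zs)
  map-++₃ xs ys zs = trans (cong (map f xs ++_) (sym (map-++ f ys zs))) (sym (map-++ f xs (ys ++ zs)))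

  map-++₄ : ∀ (ws xs ys zs : List X) →
            map f ws ++ map f xs ++ map f ys ++ map f zs ≡ map f (ws ++ xs ++ ys ++ zs)
  map-++₄ ws xs ys zs = trans (cong (map f ws ++_) (map-++₃ xs ys zs)) (sym (map-++ f ws _))

  module _ (s : State X) where
    F A D L R : List X
    F = fresh s
    A = active s
    D = dead s
    L = left s
    R = right s

    s′ : State Y
    s′ = mapState f s

    seed-map : ∀ l → N.seedTest s′ (map f l) ≡ M.seedTest s l
    seed-map l = cong₂ _∧_ (cong t₁ (map-++₄ L l A D)) (cong t₂ (map-++₄ R l A D))

    left-map : ∀ l → N.leftTest s′ (map f l) ≡ M.leftTest s l
    left-map l = cong₂ _∧_ (cong t₁ (map-++₄ l F A D)) (cong t₂ (sym (map-++ f l D)))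

    right-map : ∀ l → N.rightTest s′ (map f l) ≡ M.rightTest s l
    right-map l = cong₂ _∧_ (cong t₂ (map-++₄ l F A D)) (cong t₁ (sym (map-++ f l F)))

    fresh-map : ∀ l → N.freshTest s′ (map f l) ≡ M.freshTest s l
    fresh-map l = cong t₂ (map-++₃ l L D)

    active-map : ∀ l → N.activeTest s′ (map f l) ≡ M.activeTest s l
    active-map l = cong t₁ (map-++₄ l R F D)

    -- The context of `keepTest` contains the output of another greedy run, whose naturality must
    -- come first.
    dead⁺-map : N.dead⁺ s′ ≡ map f (M.dead⁺ s)
    dead⁺-map = trans (cong (_++ map f D) (grow-map (N.activeTest s′) active-map [] A)) (sym (map-++ f _ D))

    keep-map : ∀ l → N.keepTest s′ (map f l) ≡ M.keepTest s l
    keep-map l = cong t₂ (trans (cong (λ d → map f l ++ map f F ++ d) dead⁺-map) (map-++₃ l F (M.dead⁺ s)))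

    add-map : ∀ ph x → N.add ph s′ (f x) ≡ mapState f (M.add ph s x)
    add-map seeding      x = cong (λ l → record s′ { fresh = l }) (accept-map (N.seedTest s′) seed-map F x)
    add-map growingLeft  x = cong (λ l → record s′ { left = l }) (accept-map (N.leftTest s′) left-map L x)
    add-map growingRight x = cong (λ l → record s′ { right = l }) (accept-map (N.rightTest s′) right-map R x)

    settle-map : ∀ ph → N.settle ph s′ ≡ mapState f (M.settle ph s)
    settle-map seeding      = refl
    settle-map growingLeft  = cong₂ (λ l a → record s′ { fresh = l ; active = a })
      (grow-map (N.freshTest s′) fresh-map [] F)
      (trans (cong (_++ map f A) (reject-map (N.freshTest s′) fresh-map [] F)) (sym (map-++ f _ A)))
    settle-map growingRight = trans
      (cong₂ (λ a d → record s′ { active = a ; dead = d ; left = grow (N.keepTest s′) [] (map f L) })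
        (reject-map (N.activeTest s′) active-map [] A) dead⁺-map)
      (cong (λ l → record (mapState f (M.settleRight s)) { left = l })
        (grow-map (N.keepTest s′) keep-map [] L))

-- An element is stored together with its position in the stream: as the oracles see
-- only sets, this is the only way to recognise an element that is stored already.
Item : Set → Set
Item E = E × ℕ

-- The check on positions realises `ind-dup`; the oracle alone would accept an element that is
-- already stored.
itemTest : {E : Set} → Oracle E → List (Item E) → Bool
itemTest o xs = o (map proj₁ xs) ∧ does (unique? ℕₚ._≟_ (map proj₂ xs))

items : {X : Set} → State X → List X
items s = fresh s ++ active s ++ dead s ++ left s ++ right s

-- `c` counts the elements read in the current pass and so is the position of the next one. The
-- length of `right s` is implicit: `cut` assigns it the remainder.
header : {X : Set} → ℕ → State X → List ℕ
header c s = c ∷ length (fresh s) ∷ length (active s) ∷ length (dead s) ∷ length (left s) ∷ []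

encode : {E : Set} → ℕ → State (Item E) → Mem E
encode c s = mem (map proj₁ (items s)) (header c s ++ map proj₂ (items s))

cut : {X : Set} → (f a d l : ℕ) → List X → State X
cut f a d l xs = state (proj₁ x₁) (proj₁ x₂) (proj₁ x₃) (proj₁ x₄) (proj₂ x₄)
  where
  x₁ x₂ x₃ x₄ : _
  x₁ = splitAt f xs
  x₂ = splitAt a (proj₂ x₁)
  x₃ = splitAt d (proj₂ x₂)
  x₄ = splitAt l (proj₂ x₃)

decode : {E : Set} → Mem E → ℕ × State (Item E)
decode (mem es (c ∷ f ∷ a ∷ d ∷ l ∷ ps)) = c , cut f a d l (zip es ps)
-- A default that no run meets: all its memories come from `encode`, the initial one being
-- `encode 0 empty`.
decode _                                 = 0 , state [] [] [] [] []

splitAt-++ : {X : Set} (xs ys : List X) → splitAt (length xs) (xs ++ ys) ≡ (xs , ys)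
splitAt-++ []       ys = refl
splitAt-++ (x ∷ xs) ys rewrite splitAt-++ xs ys = refl

zip-map : {A B : Set} (xs : List (A × B)) → zip (map proj₁ xs) (map proj₂ xs) ≡ xs
zip-map []       = refl
zip-map (x ∷ xs) = cong (x ∷_) (zip-map xs)

decode-encode : {E : Set} (c : ℕ) (s : State (Item E)) → decode (encode c s) ≡ (c , s)
decode-encode c s@(state F A R B₁ B₂)
  rewrite zip-map (items s)
        | splitAt-++ F (A ++ R ++ B₁ ++ B₂)
        | splitAt-++ A (R ++ B₁ ++ B₂)
        | splitAt-++ R (B₁ ++ B₂)
        | splitAt-++ B₁ B₂ = refl

-- The recursion has period two and stops at 1 or 2, so seeding never recurs.
phase : ℕ → Phase
phase 0                   = seeding
phase 1                   = growingLeft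
phase 2                   = growingRight
phase (suc (suc (suc i))) = phase (suc i)

phase-left : ∀ j → phase (suc (j * 2)) ≡ growingLeft
phase-left zero    = refl
phase-left (suc j) = phase-left j

phase-right : ∀ j → phase (suc (suc (j * 2))) ≡ growingRight
phase-right zero    = refl
phase-right (suc j) = phase-right j

empty : {X : Set} → State X
empty = state [] [] [] [] []

advance : {E : Set} → Oracle E → Oracle E → Phase → E → ℕ × State (Item E) → Mem E
advance o₁ o₂ ph e (c , s) = encode (suc c) (Streaming.add (itemTest o₁) (itemTest o₂) ph s (e , c))

conclude : {E : Set} → Bool → State (Item E) → Mem E ⊎ List E
conclude stop s = if stop then inj₂ (map proj₁ (augmented s)) else inj₁ (encode 0 s)

finish : {E : Set} → Oracle E → Oracle E → Phase → Bool → ℕ × State (Item E) → Mem E ⊎ List E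
finish o₁ o₂ ph stop (c , s) = conclude stop (Streaming.settle (itemTest o₁) (itemTest o₂) ph s)

-- One seeding pass, then K rounds of two passes each.
algorithm : ℕ → StreamAlg
algorithm K = record
  { init    = λ _ → header 0 (empty {ℕ})
  ; step    = λ o₁ o₂ _ i m e → advance o₁ o₂ (phase i) e (decode m)
  ; endPass = λ o₁ o₂ _ i m → finish o₁ o₂ (phase i) (i ≡ᵇ K * 2) (decode m)
  }

-- Matroids on a stream

∈-fromList⁺ : ∀ {n} {x : Fin n} {xs} → x ∈ xs → x Sub.∈ fromList xs
∈-fromList⁺ {xs = y ∷ ys} (here refl) = Subₚ.x∈p∪q⁺ (inj₁ (Subₚ.x∈⁅x⁆ y))
∈-fromList⁺ {xs = y ∷ ys} (there x∈)  = Subₚ.x∈p∪q⁺ (inj₂ (∈-fromList⁺ x∈))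

∈-fromList⁻ : ∀ {n} {x : Fin n} xs → x Sub.∈ fromList xs → x ∈ xs
∈-fromList⁻ []       x∈ = contradiction x∈ Subₚ.∉⊥
∈-fromList⁻ (y ∷ ys) x∈ with Subₚ.x∈p∪q⁻ ⁅ y ⁆ (fromList ys) x∈
... | inj₁ x∈y  = here (Subₚ.x∈⁅y⁆⇒x≡y y x∈y)
... | inj₂ x∈ys = there (∈-fromList⁻ ys x∈ys)

fromList-⊆ : ∀ {n} {xs ys : List (Fin n)} → (∀ {x} → x ∈ xs → x ∈ ys) → fromList xs Sub.⊆ fromList ys
fromList-⊆ {xs = xs} xs⊆ys = ∈-fromList⁺ ∘ xs⊆ys ∘ ∈-fromList⁻ xs

∣⁅x⁆∪p∣ : ∀ {n} (x : Fin n) (p : Subset n) → x Sub.∉ p → ∣ ⁅ x ⁆ ∪ p ∣ ≡ suc ∣ p ∣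
∣⁅x⁆∪p∣ zero    (inside  ∷ᵥ p) x∉ = contradiction hereᵥ x∉
∣⁅x⁆∪p∣ zero    (outside ∷ᵥ p) x∉ = cong (suc ∘ ∣_∣) (Subₚ.∪-identityˡ p)
∣⁅x⁆∪p∣ (suc x) (inside  ∷ᵥ p) x∉ = cong suc (∣⁅x⁆∪p∣ x p (x∉ ∘ thereᵥ))
∣⁅x⁆∪p∣ (suc x) (outside ∷ᵥ p) x∉ = ∣⁅x⁆∪p∣ x p (x∉ ∘ thereᵥ)

∣fromList∣ : ∀ {n} {xs : List (Fin n)} → Unique xs → ∣ fromList xs ∣ ≡ length xs
∣fromList∣ {n} []             = Subₚ.∣⊥∣≡0 n
∣fromList∣ {n} {x ∷ xs} (x∉ ∷ u) =
  trans (∣⁅x⁆∪p∣ x (fromList xs) (All¬⇒¬Any x∉ ∘ ∈-fromList⁻ xs)) (cong suc (∣fromList∣ u))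

elements : ∀ {n} → Subset n → List (Fin n)
elements {n} A = filter (Subₚ._∈? A) (allFin n)

elements-unique : ∀ {n} (A : Subset n) → Unique (elements A)
elements-unique {n} A = Uniqueₚ.filter⁺ (Subₚ._∈? A) (Uniqueₚ.allFin⁺ n)

fromList-elements : ∀ {n} (A : Subset n) → fromList (elements A) ≡ A
fromList-elements A = Subₚ.⊆-antisym
  (proj₂ ∘ ∈-filter⁻ (Subₚ._∈? A) {xs = allFin _} ∘ ∈-fromList⁻ (elements A))
  (λ {x} x∈ → ∈-fromList⁺ (∈-filter⁺ (Subₚ._∈? A) (∈-allFin x) x∈))

∣elements∣ : ∀ {n} (A : Subset n) → length (elements A) ≡ ∣ A ∣
∣elements∣ A = trans (sym (∣fromList∣ (elements-unique A))) (cong ∣_∣ (fromList-elements A))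

-- Positions in the stream

position : ∀ {n} → List (Fin n) → Fin n → ℕ
position []       x = 0
position (y ∷ ys) x with x Fin.≟ y
... | yes _ = 0
... | no _  = suc (position ys x)

position-≤ : ∀ {n} ys (x : Fin n) → position ys x ≤ length ys
position-≤ []       x = z≤n
position-≤ (y ∷ ys) x with x Fin.≟ y
... | yes _ = z≤n
... | no _  = s≤s (position-≤ ys x)

-- An absent element gets position `length ys`, which no member has; membership of `x` thus forces
-- `z` to be a member too.
position-injective : ∀ {n} ys {x z : Fin n} → x ∈ ys → position ys x ≡ position ys z → x ≡ z
position-injective (y ∷ ys) {x} {z} x∈ eq with x Fin.≟ y | z Fin.≟ y
... | yes x≡y | yes z≡y = trans x≡y (sym z≡y)
... | no x≢y  | no _    with x∈
...   | here x≡y = contradiction x≡y x≢y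
...   | there x∈ = position-injective ys x∈ (ℕₚ.suc-injective eq)

-- Stated along the list, so that induction over a pass finds the counter `c` equal to the position
-- of each arriving element.
data Located {n} (pos : Fin n → ℕ) : ℕ → List (Fin n) → Set where
  []  : ∀ {c} → Located pos c []
  _∷_ : ∀ {c x xs} → pos x ≡ c → Located pos (suc c) xs → Located pos c (x ∷ xs)

-- `ys` is a suffix of the stream starting at offset `c`; by uniqueness its head does not recur, so
-- the positions of the tail are shifted by exactly one.
locate : ∀ {n} {pos : Fin n → ℕ} c ys → Unique ys →
         (∀ {x} → x ∈ ys → pos x ≡ c + position ys x) → Located pos c ys
locate c []       u        h = []
locate {pos = pos} c (y ∷ ys) (y∉ ∷ u) h = at-head ∷ locate (suc c) ys u at-tail
  where
  at-head : pos y ≡ c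
  at-head with y Fin.≟ y | h (here refl)
  ... | yes _ | eq = trans eq (ℕₚ.+-identityʳ c)
  ... | no ¬r | _  = contradiction refl ¬r
  at-tail : ∀ {x} → x ∈ ys → pos x ≡ suc c + position ys x
  at-tail {x} x∈ with x Fin.≟ y | h (there x∈)
  ... | yes x≡y | _  = contradiction (sym x≡y) (All.lookup y∉ x∈)
  ... | no _    | eq = trans eq (ℕₚ.+-suc c _)

-- Decides P by the Boolean an oracle returns.
recheck : {P : Set} → Dec P → Dec P
does  (recheck d)       = ⌊ d ⌋
proof (recheck (yes p)) = ofʸ p
proof (recheck (no ¬p)) = ofⁿ ¬p

module OnStream {n : ℕ} (stream : List (Fin n)) (isStream : IsStream n stream) where
  open import Data.List.Relation.Binary.Permutation.Setoid.Properties (setoid (Fin n)) using (Unique-resp-↭)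

  complete : ∀ x → x ∈ stream
  complete x = ∈-resp-↭ (↭-sym isStream) (∈-allFin x)

  stream-unique : Unique stream
  stream-unique = Unique-resp-↭ (↭⇒↭ₛ (↭-sym isStream)) (Uniqueₚ.allFin⁺ n)

  stream-length : length stream ≡ n
  stream-length = trans (↭-length isStream) (length-tabulate id)

  item : Fin n → Item (Fin n)
  item x = x , position stream x

  located : Located (position stream) 0 stream
  located = locate 0 stream stream-unique (λ _ → refl)

  module _ (M : Matroid n) where
    MInd : List (Fin n) → Set
    MInd xs = Unique xs × Indep M (fromList xs)

    proj₁-item : ∀ xs → map proj₁ (map item xs) ≡ xs
    proj₁-item xs = trans (sym (map-∘ xs)) (map-id xs)

    to : ∀ {xs} → Indep M (fromList (map proj₁ (map item xs))) × Unique (map proj₂ (map item xs)) → MInd xs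
    to {xs} (i , u) = Uniqueₚ.map⁻ (subst Unique (sym (map-∘ xs)) u) , subst (Indep M ∘ fromList) (proj₁-item xs) i

    from : ∀ {xs} → MInd xs → Indep M (fromList (map proj₁ (map item xs))) × Unique (map proj₂ (map item xs))
    from {xs} (u , i) = subst (Indep M ∘ fromList) (sym (proj₁-item xs)) i ,
      subst Unique (map-∘ xs) (Uniqueₚ.map⁺ (position-injective stream (complete _)) u)

    listMatroid : ListMatroid (Fin n)
    listMatroid = record
      { Ind     = MInd
      -- Deciding through items makes `does ∘ ind?` unfold to `itemTest (oracle M) ∘ map item`, so
      -- that `Naturality` applies without further rewriting.
      ; ind?    = λ xs → map′ to from (recheck (indep? M (fromList (map proj₁ (map item xs))))
                                       ×-dec unique? ℕₚ._≟_ (map proj₂ (map item xs)))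
      ; ind-[]  = [] , indep-∅ M
      ; ind-↭   = λ p (u , i) → Unique-resp-↭ (↭⇒↭ₛ p) u , indep-down M (fromList-⊆ (∈-resp-↭ (↭-sym p))) i
      ; ind-++ʳ = λ xs {ys} (u , i) → dropU xs u , indep-down M (fromList-⊆ (∈-++⁺ʳ xs)) i
      ; ind-dup = λ { x∈ ((x∉ ∷ _) , _) → All¬⇒¬Any x∉ x∈ }
      ; ind-aug = aug
      }
      where
      dropU : ∀ xs {ys} → Unique (xs ++ ys) → Unique ys
      dropU []       u       = u
      dropU (x ∷ xs) (_ ∷ u) = dropU xs u
      aug : ∀ {xs ys} → MInd xs → MInd ys → length xs < length ys → ∃[ x ] (x ∈ ys × MInd (x ∷ xs))
      aug {xs} {ys} (u , i) (v , j) lt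
        with x , x∈ , x∉ , k ← indep-aug M i j (subst₂ _<_ (sym (∣fromList∣ u)) (sym (∣fromList∣ v)) lt) =
        x , ∈-fromList⁻ ys x∈ , ¬Any⇒All¬ xs (x∉ ∘ ∈-fromList⁺) ∷ u , subst (Indep M) (Subₚ.∪-comm (fromList xs) ⁅ x ⁆) k

    length≤rank : ∀ {r xs} → IsRank M r → MInd xs → length xs ≤ r
    length≤rank (_ , bound) (u , i) = subst (_≤ _) (∣fromList∣ u) (bound _ i)

-- Runs of the algorithm

module Rounds {X : Set} (M₁ M₂ : ListMatroid X) {V : List X} (complete : ∀ v → v ∈ V) where
  open Analysis M₁ M₂ public
  module S = Streaming (does ∘ ind? M₁) (does ∘ ind? M₂)

  -- The part of the invariant that survives every single step, also in the middle of a pass; it is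
  -- all that the memory bound needs.
  Small : State X → Set
  Small s = Ind M₁ (left s ++ basis s) × Ind M₂ (right s ++ basis s)

  accept-valid : ∀ {P Q : List X → Set} (H : Hereditary P) acc x →
                 (P (x ∷ acc) → Q (x ∷ acc)) → Q acc → Q (accept (test H) acc x)
  accept-valid H acc x h q with dec H (x ∷ acc)
  ... | yes p = h p
  ... | no _  = q

  add-small : ∀ ph s x → Small s → Small (S.add ph s x)
  add-small seeding s x small =
    accept-valid {Q = λ l → Ind M₁ (left s ++ l ++ ad) × Ind M₂ (right s ++ l ++ ad)}
      (between M₁ (left s) ad ∩ʰ between M₂ (right s) ad) (fresh s) x id small
    where
    ad : List X
    ad = active s ++ dead s
  add-small growingLeft s x (small₁ , small₂) =
    accept-valid {Q = λ l → Ind M₁ (l ++ basis s)}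
      (between M₁ [] (basis s) ∩ʰ between M₂ [] (dead s)) (left s) x proj₁ small₁ , small₂
  add-small growingRight s x (small₁ , small₂) = small₁ ,
    accept-valid {Q = λ l → Ind M₂ (l ++ basis s)}
      (between M₂ [] (basis s) ∩ʰ between M₁ [] (fresh s)) (right s) x proj₁ small₂

  -- No test reads the list that its own pass enlarges, so it is constant during the pass, and the
  -- pass is one greedy run.
  pass-seed : ∀ s xs → foldl (S.add seeding) s xs ≡ record s { fresh = grow (seedTest s) (fresh s) xs }
  pass-seed s []       = refl
  pass-seed s (x ∷ xs) = pass-seed (S.add seeding s x) xs

  pass-left : ∀ s xs → foldl (S.add growingLeft) s xs ≡ record s { left = grow (leftTest s) (left s) xs }
  pass-left s []       = refl
  pass-left s (x ∷ xs) = pass-left (S.add growingLeft s x) xs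

  pass-right : ∀ s xs → foldl (S.add growingRight) s xs ≡ record s { right = grow (rightTest s) (right s) xs }
  pass-right s []       = refl
  pass-right s (x ∷ xs) = pass-right (S.add growingRight s x) xs

  seeded : State X
  seeded = record empty { fresh = grow (seedTest empty) [] V }

  seeded-invariant : Invariant seeded
  seeded-invariant = record
    { maximal = maximal
    ; left₁   = proj₁ valid
    ; left₂   = proj₂ valid
    ; right₁  = proj₁ valid
    ; right₂  = proj₂ valid
    ; ∣left∣  = refl
    ; ∣right∣ = refl
    ; blocked = λ v h₂ h₁ → maximal v (subst (Ind M₁ ∘ (v ∷_)) (sym (++-identityʳ _)) h₁) h₂
    }
    where
    H : Hereditary _
    H = between M₁ [] [] ∩ʰ between M₂ [] []
    valid : Ind M₁ (basis seeded) × Ind M₂ (basis seeded)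
    valid = grow-valid H [] V (ind-[] M₁ , ind-[] M₂)
    maximal : ∀ v → Ind M₁ (v ∷ basis seeded) → ¬ Ind M₂ (v ∷ basis seeded)
    maximal v h₁ h₂ = All.lookup (grow-maximal H [] V) (complete v) (h₁ , h₂)

  module _ {O : List X} (o₁ : Ind M₁ O) (o₂ : Ind M₂ O) where

    -- The least number of elements that died in one round is a bound for the gap to
    -- 3/2-optimality, and the j rounds together cannot kill more than the whole basis.
    record Progress (j : ℕ) (s : State X) : Set where
      field
        invariant : Invariant s
        gap       : ℕ
        gap-dead  : j * gap ≤ length (dead s)
        gap-bound : 2 * length O ≤ 3 * (length (right s) + length (basis s)) + gap

    progress-start : Progress 0 seeded
    progress-start = record
      { invariant = seeded-invariant
      -- Before the first round a trivial gap will do, because `0 * gap` vanishes.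
      ; gap       = 2 * length O
      ; gap-dead  = z≤n
      ; gap-bound = ℕₚ.m≤n+m (2 * length O) (3 * (length (right seeded) + length (basis seeded)))
      }

    -- If this round kills at most `gap` elements, its own bound takes over with the smaller gap.
    -- Otherwise at least `gap` more have died, and the old bound persists because `right` grows and
    -- the basis keeps its size.
    progress-round : ∀ {j s} (pr : Progress j s) → Progress (suc j) (Round.s₄ complete (Progress.invariant pr))
    progress-round {j} {s} pr with ℕₚ.≤-total (length T) gap
      where
      open Progress pr
      open Round complete invariant using (T)
    ... | inj₁ T≤gap = record
      { invariant = R.invariant
      ; gap       = length R.T
      ; gap-dead  = subst (suc j * length R.T ≤_) (sym R.dead-grows)
                      (ℕₚ.+-monoʳ-≤ (length R.T) (ℕₚ.≤-trans (ℕₚ.*-monoʳ-≤ j T≤gap) gap-dead))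
      ; gap-bound = R.bound o₁ o₂
      }
      where
      open Progress pr
      module R = Round complete invariant
    ... | inj₂ gap≤T = record
      { invariant = R.invariant
      ; gap       = gap
      ; gap-dead  = subst (suc j * gap ≤_) (sym R.dead-grows) (ℕₚ.+-mono-≤ gap≤T gap-dead)
      ; gap-bound = ℕₚ.≤-trans gap-bound (ℕₚ.+-monoˡ-≤ gap (ℕₚ.*-monoʳ-≤ 3
                      (ℕₚ.+-mono-≤ R.right-grows (ℕₚ.≤-reflexive (↭-length R.S₄-perm)))))
      }
      where
      open Progress pr
      module R = Round complete invariant

    record Trace (j : ℕ) (s : State X) : Set where
      field
        {s₂ s₄}     : State X
        left-pass   : S.settle growingLeft (foldl (S.add growingLeft) s V) ≡ s₂
        small₂      : Small s₂
        right-pass  : S.settle growingRight (foldl (S.add growingRight) s₂ V) ≡ s₄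
        next        : Progress (suc j) s₄

      small₄ : Small s₄
      small₄ = Invariant.left₁ (Progress.invariant next) , Invariant.right₂ (Progress.invariant next)

    trace : ∀ {j s} → Progress j s → Trace j s
    trace {j} {s} pr = record
      { s₂         = R.s₂
      ; s₄         = R.s₄
      ; left-pass  = cong (S.settle growingLeft) (pass-left s V)
      ; small₂     = ind-↭ M₁ (++⁺ˡ R.L R.S-perm) (proj₁ R.L-valid) ,
                     ind-↭ M₂ (++⁺ˡ (right s) R.S-perm) (Invariant.right₂ (Progress.invariant pr))
      ; right-pass = cong (S.settle growingRight) (pass-right R.s₂ V)
      ; next       = progress-round pr
      }
      where
      module R = Round complete (Progress.invariant pr)

module GoSteps (A : StreamAlg) {E : Set} (o₁ o₂ : Oracle E) (n : ℕ) (stream : List E) where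
  open Run A o₁ o₂ n stream

  go-stop : ∀ f i m {m′ s w out} → pass i m stream ≡ (m′ , s , w) →
            endPass A o₁ o₂ n i m′ ≡ inj₂ out → go (suc f) i m ≡ just (out , suc i , s , w)
  go-stop f i m eq end rewrite eq | end = refl

  go-continue : ∀ f i m {m′ m″ s w out p s′ w′} → pass i m stream ≡ (m′ , s , w) →
                endPass A o₁ o₂ n i m′ ≡ inj₁ m″ → go f (suc i) m″ ≡ just (out , p , s′ , w′) →
                go (suc f) i m ≡ just (out , p , s ⊔ size m″ ⊔ s′ , w ⊔ maxWord m″ ⊔ w′)
  go-continue f i m eq end rest rewrite eq | end | rest = refl

items-map : {X Y : Set} (f : X → Y) (s : State X) → items (mapState f s) ≡ map f (items s)
items-map f (state F A D L R) = sym
  (trans (map-++ f F _) (cong (map f F ++_)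
    (trans (map-++ f A _) (cong (map f A ++_)
      (trans (map-++ f D _) (cong (map f D ++_) (map-++ f L R)))))))

augmented-item : {X : Set} (f : X → ℕ) (s : State X) →
                 map proj₁ (augmented (mapState (λ x → x , f x) s)) ≡ augmented s
augmented-item {X} f s@(state F A D L R) = trans (cong (map proj₁) (sym eq)) (trans (sym (map-∘ _)) (map-id _))
  where
  g : X → X × ℕ
  g x = x , f x
  eq : map g (augmented s) ≡ augmented (mapState g s)
  eq = trans (map-++ g L _) (cong (map g L ++_)
    (trans (map-++ g R _) (cong (map g R ++_) (map-++ g F D))))

maxWord-≤ : ∀ {b ws} → All (_≤ b) ws → foldr _⊔_ 0 ws ≤ b
maxWord-≤ []       = z≤n
maxWord-≤ (h ∷ hs) = ℕₚ.⊔-lub h (maxWord-≤ hs)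

-- Execution of the algorithm within its resource bounds

module Execution {n : ℕ} (M₁ M₂ : Matroid n) {r₁ r₂ : ℕ} (rank₁ : IsRank M₁ r₁) (rank₂ : IsRank M₂ r₂)
                 (stream : List (Fin n)) (isStream : IsStream n stream) (K : ℕ) where
  open OnStream stream isStream
  open Rounds (listMatroid M₁) (listMatroid M₂) complete public

  A : StreamAlg
  A = algorithm K

  o₁ o₂ : Oracle (Fin n)
  o₁ = oracle M₁
  o₂ = oracle M₂

  open Run A o₁ o₂ n stream
  open GoSteps A o₁ o₂ n stream
  module N = Naturality item (itemTest o₁) (itemTest o₂)

  code : ℕ → State (Fin n) → Mem (Fin n)
  code c s = encode c (mapState item s)

  rank≤n : ∀ M {r} → IsRank {n} M r → r ≤ n
  rank≤n M ((B , _ , eq) , _) = subst (_≤ n) eq (Subₚ.∣p∣≤n B)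

  r : ℕ
  r = r₁ + r₂

  -- `left s ++ basis s` fits into `r₁` and `right s ++ basis s` into `r₂`; together they even count
  -- the basis twice.
  items-size : ∀ s → Small s → length (items s) ≤ r
  items-size s (small₁ , small₂) = begin
    length (items s)                                        ≡⟨ length-++ (fresh s) ⟩
    f + length (active s ++ dead s ++ left s ++ right s)    ≡⟨ cong (_+_ f) (trans (length-++ (active s)) (cong (_+_ a)
                                                                 (trans (length-++ (dead s)) (cong (_+_ d) (length-++ (left s)))))) ⟩
    f + (a + (d + (l + g)))                                 ≤⟨ ℕₚ.m≤m+n _ (f + (a + d)) ⟩
    f + (a + (d + (l + g))) + (f + (a + d))                 ≡⟨ solveℕ 5 (λ f a d l g → f :+ (a :+ (d :+ (l :+ g))) :+ (f :+ (a :+ d)) :=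
                                                                 (l :+ (f :+ (a :+ d))) :+ (g :+ (f :+ (a :+ d)))) refl f a d l g ⟩
    l + (f + (a + d)) + (g + (f + (a + d)))                 ≡⟨ cong (λ b → l + b + (g + b)) (length-++₃ (fresh s) (active s) (dead s)) ⟨
    l + length (basis s) + (g + length (basis s))           ≡⟨ cong₂ _+_ (length-++ (left s)) (length-++ (right s)) ⟨
    length (left s ++ basis s) + length (right s ++ basis s) ≤⟨ ℕₚ.+-mono-≤ (length≤rank M₁ rank₁ small₁) (length≤rank M₂ rank₂ small₂) ⟩
    r ∎
    where
    open ℕₚ.≤-Reasoning
    f a d l g : ℕ
    f = length (fresh s)
    a = length (active s)
    d = length (dead s)
    l = length (left s)
    g = length (right s)

  -- At most `r` elements, five header words and one position per element. Counter and positions are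
  -- at most `n`, and the stored lengths at most `r₁ + r₂`, hence at most `n + n`.
  memory word : ℕ
  memory = r + (5 + r)
  word   = n + n

  code-size : ∀ c s → Small s → size (code c s) ≤ memory
  code-size c s small = ℕₚ.+-mono-≤ (le (length-map proj₁ (items s′))) (s≤s (s≤s (s≤s (s≤s (s≤s (le (length-map proj₂ (items s′))))))))
    where
    s′ : State (Item (Fin n))
    s′ = mapState item s
    le : ∀ {k} → k ≡ length (items s′) → k ≤ r
    le eq = subst (_≤ r) (sym (trans eq (trans (cong length (items-map item s)) (length-map item (items s))))) (items-size s small)

  code-words : ∀ c s → c ≤ n → Small s → maxWord (code c s) ≤ word
  code-words c s c≤n small = maxWord-≤
    (ℕₚ.≤-trans c≤n (ℕₚ.m≤m+n n n)
    ∷ len (fresh s) [] (active s ++ dead s ++ left s ++ right s) refl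
    ∷ len (active s) (fresh s) (dead s ++ left s ++ right s) refl
    ∷ len (dead s) (fresh s ++ active s) (left s ++ right s) (++-assoc (fresh s) (active s) _)
    ∷ len (left s) (fresh s ++ active s ++ dead s) (right s)
        (trans (++-assoc (fresh s) (active s ++ dead s) _) (cong (fresh s ++_) (++-assoc (active s) (dead s) _)))
    ∷ subst (All (_≤ word)) (sym (trans (cong (map proj₂) (items-map item s)) (sym (map-∘ (items s)))))
        (map⁺ (All.universal (λ x → ℕₚ.≤-trans (subst (position stream x ≤_) stream-length (position-≤ stream x)) (ℕₚ.m≤m+n n n)) (items s))))
    where
    len : ∀ ys xs zs → xs ++ ys ++ zs ≡ items s → length (map item ys) ≤ word
    len ys xs zs eq = begin
      length (map item ys)           ≡⟨ length-map item ys ⟩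
      length ys                      ≤⟨ ℕₚ.m≤m+n _ (length zs) ⟩
      length ys + length zs          ≡⟨ length-++ ys ⟨
      length (ys ++ zs)              ≤⟨ ℕₚ.m≤n+m _ (length xs) ⟩
      length xs + length (ys ++ zs)  ≡⟨ length-++ xs ⟨
      length (xs ++ ys ++ zs)        ≡⟨ cong length eq ⟩
      length (items s)               ≤⟨ items-size s small ⟩
      r₁ + r₂                        ≤⟨ ℕₚ.+-mono-≤ (rank≤n M₁ rank₁) (rank≤n M₂ rank₂) ⟩
      n + n                          ∎
      where open ℕₚ.≤-Reasoning

  -- `advance` labels the arriving element with the counter; only if this is its position does the
  -- stored pair agree with `item x`.
  step-code : ∀ i c s x → position stream x ≡ c →
              step A o₁ o₂ n i (code c s) x ≡ code (suc c) (S.add (phase i) s x)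
  step-code i c s x refl = trans
    (cong (advance o₁ o₂ (phase i) x) (decode-encode c (mapState item s)))
    (cong (encode (suc c)) (N.add-map s (phase i) x))

  end-code : ∀ i c s → endPass A o₁ o₂ n i (code c s) ≡
                       conclude (i ≡ᵇ K * 2) (mapState item (S.settle (phase i) s))
  end-code i c s = trans
    (cong (finish o₁ o₂ (phase i) (i ≡ᵇ K * 2)) (decode-encode c (mapState item s)))
    (cong (conclude (i ≡ᵇ K * 2)) (N.settle-map s (phase i)))

  run-pass : ∀ i c xs s → Located (position stream) c xs → c + length xs ≤ n → Small s →
             let s′ = foldl (S.add (phase i)) s xs in
             ∃[ c′ ] ∃[ m ] ∃[ w ]
               (pass i (code c s) xs ≡ (code c′ s′ , m , w) × m ≤ memory × w ≤ word × Small s′)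
  run-pass i c []       s loc       c≤n small = c , _ , _ , refl , code-size c s small ,
    code-words c s (subst (_≤ n) (ℕₚ.+-identityʳ c) c≤n) small , small
  run-pass i c (x ∷ xs) s (at ∷ loc) c≤n small
    with c′ , m , w , eq , m≤ , w≤ , small′ ←
           run-pass i (suc c) xs (S.add (phase i) s x) loc (subst (_≤ n) (ℕₚ.+-suc c _) c≤n) (add-small (phase i) s x small)
    rewrite step-code i c s x at | eq =
    c′ , _ , _ , refl , ℕₚ.⊔-lub (code-size c s small) m≤ , ℕₚ.⊔-lub (code-words c s (ℕₚ.m+n≤o⇒m≤o c c≤n) small) w≤ , small′

  end-continue : ∀ i {ph} c s → phase i ≡ ph → (i ≡ᵇ K * 2) ≡ false →
                 endPass A o₁ o₂ n i (code c s) ≡ inj₁ (code 0 (S.settle ph s))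
  end-continue i c s refl eq = trans (end-code i c s) (cong (λ b → conclude b (mapState item (S.settle (phase i) s))) eq)

  end-stop : ∀ i {ph} c s → phase i ≡ ph → (i ≡ᵇ K * 2) ≡ true →
             endPass A o₁ o₂ n i (code c s) ≡ inj₂ (augmented (S.settle ph s))
  end-stop i c s refl eq = trans (end-code i c s)
    (trans (cong (λ b → conclude b (mapState item s′)) eq) (cong inj₂ (augmented-item (position stream) s′)))
    where
    s′ : State (Fin n)
    s′ = S.settle (phase i) s

  odd≢even : ∀ j k → (suc (j * 2) ≡ᵇ k * 2) ≡ false
  odd≢even zero    zero    = refl
  odd≢even zero    (suc k) = refl
  odd≢even (suc j) zero    = refl
  odd≢even (suc j) (suc k) = odd≢even j k

  even≡even : ∀ j → (j * 2 ≡ᵇ j * 2) ≡ true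
  even≡even zero    = refl
  even≡even (suc j) = even≡even j

  even≢even : ∀ k j → (j * 2 ≡ᵇ (suc k + j) * 2) ≡ false
  even≢even k zero    = refl
  even≢even k (suc j) = subst (λ l → (j * 2 ≡ᵇ l * 2) ≡ false) (sym (ℕₚ.+-suc k j)) (even≢even k j)

  module _ {O : List (Fin n)} (O₁ : Ind (listMatroid M₁) O) (O₂ : Ind (listMatroid M₂) O) where

    -- Couples the result of the run with its guarantee, so that the induction over rounds yields
    -- both for the same final state.
    record Outcome (fuel i : ℕ) (s : State (Fin n)) : Set where
      constructor outcome
      field
        {final}  : State (Fin n)
        {m w}    : ℕ
        halts    : go fuel i (code 0 s) ≡ just (augmented final , suc (K * 2) , m , w)
        m≤       : m ≤ memory
        w≤       : w ≤ word
        progress : Progress O₁ O₂ K final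

    continue : ∀ i f {ph s s′} → phase i ≡ ph → (i ≡ᵇ K * 2) ≡ false → Small s →
               S.settle ph (foldl (S.add ph) s stream) ≡ s′ → Small s′ →
               Outcome f (suc i) s′ → Outcome (suc f) i s
    continue i f {s = s} refl i≢ small refl small′ (outcome eq′ m′≤ w′≤ pr)
      with c , m , w , eq , m≤ , w≤ , _ ← run-pass i 0 stream s located (ℕₚ.≤-reflexive stream-length) small =
      outcome (go-continue f i _ eq (end-continue i c _ refl i≢) eq′)
        (ℕₚ.⊔-lub (ℕₚ.⊔-lub m≤ (code-size 0 s₂ small′)) m′≤)
        (ℕₚ.⊔-lub (ℕₚ.⊔-lub w≤ (code-words 0 s₂ z≤n small′)) w′≤) pr
      where
      s₂ : State (Fin n)
      s₂ = S.settle (phase i) (foldl (S.add (phase i)) s stream)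

    stop : ∀ i f {ph s s′} → phase i ≡ ph → i ≡ K * 2 → (i ≡ᵇ K * 2) ≡ true → Small s →
           S.settle ph (foldl (S.add ph) s stream) ≡ s′ →
           Progress O₁ O₂ K s′ → Outcome (suc f) i s
    stop i f {s = s} refl refl i≡ small refl pr
      with c , m , w , eq , m≤ , w≤ , _ ← run-pass i 0 stream s located (ℕₚ.≤-reflexive stream-length) small =
      outcome (go-stop f i _ eq (end-stop i c _ refl i≡)) m≤ w≤ pr

    last-round : ∀ j {s} (tr : Trace O₁ O₂ j s) → Small s → suc j ≡ K → Outcome 2 (suc (j * 2)) s
    last-round j tr small K≡ = continue (suc (j * 2)) 1 (phase-left j) (odd≢even j K) small left-pass small₂
      (stop (suc j * 2) 0 (phase-right j) (cong (_* 2) K≡)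
        (subst (λ l → (suc j * 2 ≡ᵇ l * 2) ≡ true) K≡ (even≡even j)) small₂ right-pass
        (subst (λ l → Progress O₁ O₂ l s₄) K≡ next))
      where open Trace tr

    inner-round : ∀ k j f {s} (tr : Trace O₁ O₂ j s) → Small s → suc k + suc j ≡ K →
                  Outcome f (suc (suc j * 2)) (Trace.s₄ tr) → Outcome (suc (suc f)) (suc (j * 2)) s
    inner-round k j f tr small K≡ rest =
      continue (suc (j * 2)) (suc f) (phase-left j) (odd≢even j K) small left-pass small₂
        (continue (suc j * 2) f (phase-right j)
          (subst (λ l → (suc j * 2 ≡ᵇ l * 2) ≡ false) K≡ (even≢even k (suc j))) small₂ right-pass small₄ rest)
      where open Trace tr

    -- With `j` rounds done, `suc k` remain; the fuel is exactly their number of passes, and the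
    -- offset of the pass index accounts for seeding.
    rounds : ∀ k j {s} → Progress O₁ O₂ j s → suc k + j ≡ K → Outcome (suc k * 2) (suc (j * 2)) s
    rounds zero    j pr K≡ = last-round j (trace O₁ O₂ pr) (left₁ , right₂) K≡
      where open Invariant (Progress.invariant pr) using (left₁; right₂)
    rounds (suc k) j pr K≡ = inner-round k j (suc k * 2) (trace O₁ O₂ pr) (left₁ , right₂) K≡′
      (rounds k (suc j) (Trace.next (trace O₁ O₂ pr)) K≡′)
      where
      open Invariant (Progress.invariant pr) using (left₁; right₂)
      K≡′ : suc k + suc j ≡ K
      K≡′ = trans (cong suc (ℕₚ.+-suc k j)) K≡

    -- A positive `K` prevents the stopping test from firing at the seeding pass.
    execution : ∀ {k} → K ≡ suc k → Outcome (suc (K * 2)) 0 empty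
    execution {k} refl = continue 0 (suc k * 2) refl refl
      (ind-[] (listMatroid M₁) , ind-[] (listMatroid M₂))
      (pass-seed empty stream)
      (Invariant.left₁ seeded-invariant , Invariant.right₂ seeded-invariant)
      (rounds k 0 (progress-start O₁ O₂) (ℕₚ.+-identityʳ (suc k)))

    record Solution : Set where
      field
        {S}      : List (Fin n)
        {m w}    : ℕ
        halts    : Halts (S , suc (K * 2) , m , w)
        common   : CommonIndep M₁ M₂ (fromList S)
        m≤       : m ≤ memory
        w≤       : w ≤ word
        gap      : ℕ
        gap-size : K * gap ≤ ∣ fromList S ∣
        optimum  : 2 * length O ≤ 3 * ∣ fromList S ∣ + gap

    solution : Outcome (suc (K * 2)) 0 empty → Solution
    solution o = record
      { halts    = suc (K * 2) , halts
      ; common   = proj₂ augmented₁ , proj₂ augmented₂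
      ; m≤       = m≤
      ; w≤       = w≤
      ; gap      = gap
      -- All dead elements remain in the output, so its size bounds their number.
      ; gap-size = ℕₚ.≤-trans gap-dead (subst (length (dead final) ≤_) (sym size≡) (dead≤size final))
      ; optimum  = subst (λ k → 2 * length O ≤ 3 * k + gap) (sym size≡) gap-bound
      }
      where
      open Outcome o
      open Progress progress
      open Invariant invariant
      size≡ : ∣ fromList (augmented final) ∣ ≡ length (right final) + length (basis final)
      size≡ = trans (∣fromList∣ (proj₁ augmented₁)) ∣augmented∣
      dead≤size : ∀ (s : State (Fin n)) → length (dead s) ≤ length (right s) + length (basis s)
      dead≤size s rewrite length-++₃ (fresh s) (active s) (dead s) =
        ℕₚ.≤-trans (ℕₚ.m≤n+m _ (length (active s)))
          (ℕₚ.≤-trans (ℕₚ.m≤n+m _ (length (fresh s))) (ℕₚ.m≤n+m _ (length (right s))))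

-- From natural numbers to ε

toℚᵘ-ℕ→ℚ : ∀ k → toℚᵘ (ℕ→ℚ k) ℚᵘ.≃ mkℚᵘ (+ k) 0
toℚᵘ-ℕ→ℚ k = ℚₚ.toℚᵘ-fromℚᵘ (mkℚᵘ (+ k) 0)

module Fraction (a d-1 : ℕ) .(c : Coprime a (suc d-1)) where
  ε : ℚ
  ε = mkℚ (+ a) d-1 c
  d : ℕ
  d = suc d-1

  scaled-≤ : ∀ x y → x * a ≤ y * d → ℕ→ℚ x *ℚ ε ≤ℚ ℕ→ℚ y
  scaled-≤ x y le = ℚₚ.toℚᵘ-cancel-≤ (begin
    toℚᵘ (ℕ→ℚ x *ℚ ε)                 ≃⟨ ℚₚ.toℚᵘ-homo-* (ℕ→ℚ x) ε ⟩
    toℚᵘ (ℕ→ℚ x) ℚᵘ.* toℚᵘ ε          ≃⟨ ℚᵘₚ.*-congʳ (toℚᵘ-ℕ→ℚ x) ⟩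
    mkℚᵘ (+ x) 0 ℚᵘ.* mkℚᵘ (+ a) d-1  ≤⟨ ℚᵘ.*≤* cleared ⟩
    mkℚᵘ (+ y) 0                      ≃⟨ toℚᵘ-ℕ→ℚ y ⟨
    toℚᵘ (ℕ→ℚ y)                      ∎)
    where
    open ℚᵘₚ.≤-Reasoning
    cleared : (+ x ℤ.* + a) ℤ.* + 1 ℤ.≤ + y ℤ.* + (1 * d)
    cleared = subst₂ ℤ._≤_ (trans (ℤₚ.pos-* x a) (sym (ℤₚ.*-identityʳ _)))
      (trans (ℤₚ.pos-* y d) (cong (λ z → + y ℤ.* + z) (sym (ℕₚ.*-identityˡ d)))) (ℤ.+≤+ le)

  -- The hypothesis is the conclusion multiplied by 3d, with the negative term moved to the right so
  -- that natural numbers suffice.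
  two-thirds-≤ : ∀ r s → 2 * d * r ≤ 3 * d * s + 3 * a * r → ((+ 2 / 3) - ε) *ℚ ℕ→ℚ r ≤ℚ ℕ→ℚ s
  two-thirds-≤ r s le = ℚₚ.toℚᵘ-cancel-≤ (begin
    toℚᵘ (((+ 2 / 3) - ε) *ℚ ℕ→ℚ r)  ≃⟨ ℚₚ.toℚᵘ-homo-* ((+ 2 / 3) - ε) (ℕ→ℚ r) ⟩
    toℚᵘ ((+ 2 / 3) - ε) ℚᵘ.* toℚᵘ (ℕ→ℚ r)
      ≃⟨ ℚᵘₚ.*-cong (ℚᵘₚ.≃-trans (ℚₚ.toℚᵘ-homo-+ (+ 2 / 3) (ℚ.- ε)) (ℚᵘₚ.+-congʳ (mkℚᵘ (+ 2) 2) (ℚₚ.toℚᵘ-homo‿- ε))) (toℚᵘ-ℕ→ℚ r) ⟩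
    (mkℚᵘ (+ 2) 2 ℚᵘ.+ (ℚᵘ.- mkℚᵘ (+ a) d-1)) ℚᵘ.* mkℚᵘ (+ r) 0  ≤⟨ ℚᵘ.*≤* cleared ⟩
    mkℚᵘ (+ s) 0                      ≃⟨ toℚᵘ-ℕ→ℚ s ⟨
    toℚᵘ (ℕ→ℚ s)                      ∎)
    where
    open ℚᵘₚ.≤-Reasoning
    cleared : ((+ 2 ℤ.* + d ℤ.+ (ℤ.- (+ a)) ℤ.* + 3) ℤ.* + r) ℤ.* + 1 ℤ.≤ + s ℤ.* + (3 * d * 1)
    cleared = subst₂ ℤ._≤_
      (ℤS.solve 3 (λ a d r → ℤS.con (+ 2) ℤS.:* d ℤS.:* r ℤS.:+ ℤS.:- (ℤS.con (+ 3) ℤS.:* a ℤS.:* r) ℤS.:=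
         ((ℤS.con (+ 2) ℤS.:* d ℤS.:+ (ℤS.:- a) ℤS.:* ℤS.con (+ 3)) ℤS.:* r) ℤS.:* ℤS.con (+ 1)) refl (+ a) (+ d) (+ r))
      (trans (ℤS.solve 4 (λ a d r s → ℤS.con (+ 3) ℤS.:* d ℤS.:* s ℤS.:+ ℤS.con (+ 3) ℤS.:* a ℤS.:* r ℤS.:+ ℤS.:- (ℤS.con (+ 3) ℤS.:* a ℤS.:* r) ℤS.:=
         s ℤS.:* (ℤS.con (+ 3) ℤS.:* d ℤS.:* ℤS.con (+ 1))) refl (+ a) (+ d) (+ r) (+ s))
         (cong (+ s ℤ.*_) (trans (cong (ℤ._* + 1) (sym (ℤₚ.pos-* 3 d))) (sym (ℤₚ.pos-* (3 * d) 1)))))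
      (ℤₚ.+-monoˡ-≤ (ℤ.- (+ 3 ℤ.* + a ℤ.* + r)) (subst₂ ℤ._≤_ (pos-*₃ 2 d r)
        (trans (ℤₚ.pos-+ (3 * d * s) _) (cong₂ ℤ._+_ (pos-*₃ 3 d s) (pos-*₃ 3 a r))) (ℤ.+≤+ le)))
      where
      pos-*₃ : ∀ x y z → + (x * y * z) ≡ + x ℤ.* + y ℤ.* + z
      pos-*₃ x y z = trans (ℤₚ.pos-* (x * y) z) (cong (ℤ._* + z) (ℤₚ.pos-* x y))

-- With ε = a/d the hypotheses read ε ≤ 1 and 1/ε ≤ k ≤ 1 + 1/ε.
module Arithmetic {a d k : ℕ} (a≤d : a ≤ d) (d≤ka : d ≤ k * a) (ka≤a+d : k * a ≤ a + d) where
  open ℕₚ.≤-Reasoning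

  approximation : ∀ {r s g} → k * g ≤ r → 2 * r ≤ 3 * s + g → 2 * d * r ≤ 3 * d * s + 3 * a * r
  approximation {r} {s} {g} kg≤r 2r≤ = begin
    2 * d * r                    ≡⟨ solveℕ 2 (λ d r → con 2 :* d :* r := d :* (con 2 :* r)) refl d r ⟩
    d * (2 * r)                  ≤⟨ ℕₚ.*-monoʳ-≤ d 2r≤ ⟩
    d * (3 * s + g)              ≡⟨ solveℕ 3 (λ d s g → d :* (con 3 :* s :+ g) := con 3 :* d :* s :+ d :* g) refl d s g ⟩
    3 * d * s + d * g            ≤⟨ ℕₚ.+-monoʳ-≤ (3 * d * s) (ℕₚ.*-monoˡ-≤ g d≤ka) ⟩
    3 * d * s + k * a * g        ≡⟨ cong (λ x → 3 * d * s + x) (solveℕ 3 (λ k a g → k :* a :* g := a :* (k :* g)) refl k a g) ⟩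
    3 * d * s + a * (k * g)      ≤⟨ ℕₚ.+-monoʳ-≤ (3 * d * s) (ℕₚ.*-monoʳ-≤ a kg≤r) ⟩
    -- The argument loses only ε/3; the factor 3 is given away to reach the required form.
    3 * d * s + a * r            ≤⟨ ℕₚ.+-monoʳ-≤ (3 * d * s) (ℕₚ.*-monoˡ-≤ r (ℕₚ.m≤n*m a 3)) ⟩
    3 * d * s + 3 * a * r        ∎

  -- Since kε ≤ 1 + ε ≤ 2, the product (1 + 2k)ε is at most 5; this is one source of the constant.
  pass-count : suc (k * 2) * a ≤ 5 * d
  pass-count = begin
    suc (k * 2) * a        ≡⟨ solveℕ 2 (λ k a → (con 1 :+ k :* con 2) :* a := a :+ con 2 :* (k :* a)) refl k a ⟩
    a + 2 * (k * a)        ≤⟨ ℕₚ.+-mono-≤ a≤d (ℕₚ.*-monoʳ-≤ 2 (ℕₚ.≤-trans ka≤a+d (ℕₚ.+-monoˡ-≤ d a≤d))) ⟩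
    d + 2 * (d + d)        ≡⟨ solveℕ 1 (λ d → d :+ con 2 :* (d :+ d) := con 5 :* d) refl d ⟩
    5 * d                  ∎

  -- The memory is at most 2r + 5 whatever ε is; the factor ε is absorbed by ε ≤ 1.
  memory-bound : ∀ {m r} → m ≤ r + (5 + r) → m * a ≤ 5 * (r + 1) * d
  memory-bound {m} {r} m≤ = ℕₚ.*-mono-≤ {m} (begin
    m                      ≤⟨ m≤ ⟩
    r + (5 + r)            ≤⟨ ℕₚ.m≤m+n _ (3 * r) ⟩
    r + (5 + r) + 3 * r    ≡⟨ solveℕ 1 (λ r → r :+ (con 5 :+ r) :+ con 3 :* r := con 5 :* (r :+ con 1)) refl r ⟩
    5 * (r + 1)            ∎) a≤d

word-bound : ∀ {w} n → w ≤ n + n → w < (n + 2) ^ 5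
word-bound {w} n w≤ = begin-strict
  w                        ≤⟨ w≤ ⟩
  n + n                    <⟨ ℕₚ.+-mono-< n<n+2 n<n+2 ⟩
  n + 2 + (n + 2)          ≡⟨ solveℕ 1 (λ k → k :+ k := k :* con 2) refl (n + 2) ⟩
  -- The factor 2 is at most `2 ^ 4`, hence at most `(n + 2) ^ 4`.
  (n + 2) * 2              ≤⟨ ℕₚ.*-monoʳ-≤ (n + 2) (ℕₚ.≤-trans (s≤s (s≤s z≤n)) (ℕₚ.^-monoˡ-≤ 4 (ℕₚ.m≤n+m 2 n))) ⟩
  (n + 2) ^ 5              ∎
  where
  open ℕₚ.≤-Reasoning
  n<n+2 : n < n + 2
  n<n+2 = ℕₚ.m<m+n n (s≤s z≤n)

Approximates : ℕ → ℚ → StreamAlg → Set₁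
Approximates C ε A =
  (n : ℕ) (M₁ M₂ : Matroid n) (r₁ r₂ r : ℕ) →
  IsRank M₁ r₁ → IsRank M₂ r₂ → IsMaxCommon M₁ M₂ r →
  (stream : List (Fin n)) → IsStream n stream →
  ∃[ S ] ∃[ p ] ∃[ m ] ∃[ w ]
  (Run.Halts A (oracle M₁) (oracle M₂) n stream (S , p , m , w)
  × CommonIndep M₁ M₂ (fromList S)
  × ((+ 2 / 3) - ε) *ℚ ℕ→ℚ r ≤ℚ ℕ→ℚ ∣ fromList S ∣
  × ℕ→ℚ m *ℚ ε ≤ℚ ℕ→ℚ (C * (r₁ + r₂ + 1))
  × ℕ→ℚ p *ℚ ε ≤ℚ ℕ→ℚ C
  × w < (n + 2) ^ C)

module _ (b d-1 : ℕ) .(c : Coprime (suc b) (suc d-1)) (a≤d : suc b ≤ suc d-1) where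
  open Fraction (suc b) d-1 c

  -- Rounding 1/ε down and adding one gives the number of rounds required by `Arithmetic`.
  quotient K : ℕ
  quotient = suc d-1 DivMod./ suc b
  K = suc quotient

  open Arithmetic {suc b} {suc d-1} {K} a≤d
    (subst (_≤ K * suc b) (sym (DivMod.m≡m%n+[m/n]*n (suc d-1) (suc b)))
      (ℕₚ.+-monoˡ-≤ (quotient * suc b) (ℕₚ.<⇒≤ (DivMod.m%n<n (suc d-1) (suc b)))))
    (ℕₚ.+-monoʳ-≤ (suc b) (DivMod.m/n*n≤m (suc d-1) (suc b)))

  algorithm-approximates : Approximates 5 (mkℚ (+ suc b) d-1 c) (algorithm K)
  algorithm-approximates n M₁ M₂ r₁ r₂ r rank₁ rank₂ ((O , (O₁ , O₂) , ∣O∣≡r) , ≤r) stream isStream =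
    S , suc (K * 2) , m , w , halts , common ,
    -- The output is itself a common independent set, so `K * gap` is bounded by the optimum `r`.
    two-thirds-≤ r (∣ fromList S ∣) (approximation {r} {∣ fromList S ∣} {gap} (ℕₚ.≤-trans gap-size (≤r _ common))
      (subst (λ k → 2 * k ≤ 3 * ∣ fromList S ∣ + gap) (trans (∣elements∣ O) ∣O∣≡r) optimum)) ,
    scaled-≤ m (5 * (r₁ + r₂ + 1)) (memory-bound {m} {r₁ + r₂} m≤) ,
    scaled-≤ (suc (K * 2)) 5 pass-count ,
    word-bound n w≤
    where
    module E = Execution M₁ M₂ rank₁ rank₂ stream isStream K
    O₁′ : Unique (elements O) × Indep M₁ (fromList (elements O))
    O₁′ = elements-unique O , subst (Indep M₁) (sym (fromList-elements O)) O₁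
    O₂′ : Unique (elements O) × Indep M₂ (fromList (elements O))
    O₂′ = elements-unique O , subst (Indep M₂) (sym (fromList-elements O)) O₂
    open E.Solution (E.solution O₁′ O₂′ (E.execution O₁′ O₂′ refl))

theorem3 : ∃[ C ] ((ε : ℚ) → 0ℚ <ℚ ε → ε ≤ℚ 1ℚ →
    ∃[ A ] ((n : ℕ) (M₁ M₂ : Matroid n) (r₁ r₂ r : ℕ) →
    IsRank M₁ r₁ → IsRank M₂ r₂ → IsMaxCommon M₁ M₂ r →
    (stream : List (Fin n)) → IsStream n stream →
    ∃[ S ] ∃[ p ] ∃[ m ] ∃[ w ]
    (Run.Halts A (oracle M₁) (oracle M₂) n stream (S , p , m , w)
    × CommonIndep M₁ M₂ (fromList S)
    × ((+ 2 / 3) - ε) *ℚ ℕ→ℚ r ≤ℚ ℕ→ℚ ∣ fromList S ∣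
    × ℕ→ℚ m *ℚ ε ≤ℚ ℕ→ℚ (C * (r₁ + r₂ + 1))
    × ℕ→ℚ p *ℚ ε ≤ℚ ℕ→ℚ C
    × w < (n + 2) ^ C)))
theorem3 = 5 , solve-for
  where
  solve-for : (ε : ℚ) → 0ℚ <ℚ ε → ε ≤ℚ 1ℚ → ∃[ A ] Approximates 5 ε A
  -- Positivity of ε rules out zero and negative numerators; ε ≤ 1 then compares numerator and
  -- denominator.
  solve-for (mkℚ (+ 0)     d-1 c) (*<* (ℤ.+<+ ())) _
  solve-for (mkℚ -[1+ _ ]  d-1 c) (*<* ()) _
  solve-for (mkℚ (+ suc b) d-1 c) _ (*≤* ε≤1) = _ , algorithm-approximates b d-1 c
    (ℤₚ.drop‿+≤+ (subst₂ ℤ._≤_ (ℤₚ.*-identityʳ _) (ℤₚ.*-identityˡ _) ε≤1))
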